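{- For every $\lambda_\oplus$-term $M$, $\mathcal T(\mathrm{BT}(M))=\mathrm{NF}(\mathcal T(M))$.
   Context: $\lambda_\oplus$-terms are given by $M,N,P,Q ::= x\mid\lambda x.M\mid MN\mid M\oplus N$, up to renaming of bound variables; $M[N/x]$ is capture-avoiding substitution; application associates to the left; $\lambda\vec x$ is a possibly empty sequence of abstractions. The hereditary head reduction $L$ on $\lambda_\oplus$-terms: $L(M\oplus N)=L(M)\oplus L(N)$; $L(\lambda\vec x.\lambda y.(M\oplus N))=\lambda\vec x.(\lambda y.M\oplus\lambda y.N)$; $L(\lambda\vec x.(M\oplus N)PQ_1\cdots Q_k)=\lambda\vec x.(MP\oplus NP)Q_1\cdots Q_k$; $L(\lambda\vec x.yQ_1\cdots Q_k)=\lambda\vec x.y\,L(Q_1)\cdots L(Q_k)$; $L(\lambda\vec x.(\lambda y.M)NQ_1\cdots Q_k)=\lambda\vec x.M[N/y]Q_1\cdots Q_k$ ($k\ge0$). Approximants: the same grammar with a constant $\bot$; $\le$ is the least preorder with $\bot\le M$ and compatible with constructors. Elementary Böhm trees $\mathcal N$: least set containing $\bot$, $\lambda\vec x.xN_1\cdots N_n$ for $N_i\in\mathcal N$, and $N_1\oplus N_2$ for $N_1,N_2\in\mathcal N$. $\mathrm{eBT}(M\oplus N)=\mathrm{eBT}(M)\oplus\mathrm{eBT}(N)$, $\mathrm{eBT}(\lambda\vec x.xQ_1\cdots Q_k)=\lambda\vec x.x\,\mathrm{eBT}(Q_1)\cdots\mathrm{eBT}(Q_k)$, $\mathrm{eBT}(M)=\bot$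 otherwise. $\mathrm{BT}(M)=\{N\in\mathcal N\mid\exists n,\ N\le\mathrm{eBT}(L^n(M))\}$. Resource terms and monomials: $s,t ::= x\mid\lambda x.s\mid\langle s\rangle\bar t\mid s\oplus\bullet\mid\bullet\oplus s$, $\bar t::=[t_1,\dots,t_n]$ (finite multisets). Finite formal sums with coefficients in $\mathbb N$ with supports $\mathrm{supp}(E)$; constructors extended by multilinearity. For $\bar u=[u_1,\dots,u_n]$, the symmetric multilinear substitution $\partial_xe\cdot\bar u$: $\partial_xy\cdot\bar u$ is $y$ if $y\ne x$ and $n=0$, $u_1$ if $y=x$ and $n=1$, $0$ otherwise; it commutes with $\lambda y.$ ($y$ fresh), $-\oplus\bullet$ and $\bullet\oplus-$; $\partial_x(\langle s\rangle\bar t)\cdot\bar u=\sum_{(I_1,I_2)}\langle\partial_xs\cdot\bar u_{I_1}\rangle(\partial_x\bar t\cdot\bar u_{I_2})$ and $\partial_x[t_1,\dots,t_k]\cdot\bar u=\sum_{(I_1,\dots,I_k)}[\partial_xt_1\cdot\bar u_{I_1},\dots,\partial_xt_k\cdot\bar u_{I_k}]$, sums over tuples of pairwise disjoint possibly empty subsets of $\{1,\dots,n\}$ covering it, $\bar u_I=[u_i\mid i\in I]$. The reduction $\to_\partial$ is generated by $\langle\lambda x.s\rangle\bar t\to_\partial\partial_xs\cdot\bar t$, $\langle s\oplus\bullet\rangle\bar t\to_\partial(\langle s\rangle\bar t)\oplus\bullet$, $\langle\bullet\oplus s\rangle\bar t\to_\partial\bullet\oplus\langle s\rangle\bar t$,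 $\lambda x.(s\oplus\bullet)\to_\partial(\lambda x.s)\oplus\bullet$, $\lambda x.(\bullet\oplus s)\to_\partial\bullet\oplus\lambda x.s$, closed under all contexts and extended to sums by $e+F\to_\partial E'+F$ when $e\to_\partial E'$; it is confluent and strongly normalizing, with normal form $\mathrm{NF}(E)$. For a set $E$ of resource terms, $\mathrm{NF}(E)=\bigcup_{e\in E}\mathrm{supp}(\mathrm{NF}(e))$. The Taylor support of approximants is defined by $\mathcal T(\bot)=\emptyset$, $\mathcal T(x)=\{x\}$, $\mathcal T(\lambda x.N)=\{\lambda x.t\mid t\in\mathcal T(N)\}$, $\mathcal T(PQ)=\{\langle s\rangle[t_1,\dots,t_n]\mid n\ge0,\ s\in\mathcal T(P),\ t_i\in\mathcal T(Q)\}$, $\mathcal T(P\oplus Q)=\{s\oplus\bullet\mid s\in\mathcal T(P)\}\cup\{\bullet\oplus t\mid t\in\mathcal T(Q)\}$; and $\mathcal T(\mathrm{BT}(M))=\bigcup_{B\in\mathrm{BT}(M)}\mathcal T(B)$. -}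

module Defs where

open import Data.Nat using (ℕ; zero; suc; _<ᵇ_; _≡ᵇ_; pred)
open import Data.Bool using (Bool; true; false; if_then_else_)
open import Data.List using (List; []; _∷_; _++_; concatMap; map)
open import Data.List.Relation.Unary.All using (All)
open import Data.List.Membership.Propositional using (_∈_)
open import Data.Maybe using (Maybe; just; nothing)
open import Data.Product using (Σ; ∃; _×_; _,_; ∃-syntax; proj₁; proj₂)
open import Relation.Binary.Construct.Closure.ReflexiveTransitive using (Star)
open import Relation.Nullary using (¬_)

infixl 7 _·_
infixl 6 _⊕_
data Λ : Set where
  var : ℕ → Λ
  lam : Λ → Λ
  _·_ : Λ → Λ → Λ
  _⊕_ : Λ → Λ → Λ

shift : ℕ → Λ → Λ
shift c (var y) = if y <ᵇ c then var y else var (suc y)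
shift c (lam M) = lam (shift (suc c) M)
shift c (M · N) = shift c M · shift c N
shift c (M ⊕ N) = shift c M ⊕ shift c N

-- subst k N M : capture-avoiding substitution of N for the variable k
-- in M, the binder of k being removed (free vars above k are decremented).
-- M[N/y] with y the bound variable of a redex (λy.M)N is  subst 0 N M.
subst : ℕ → Λ → Λ → Λ
subst k N (var y) = if y ≡ᵇ k then N else (if y <ᵇ k then var y else var (pred y))
subst k N (lam M) = lam (subst (suc k) (shift 0 N) M)
subst k N (M · M') = subst k N M · subst k N M'
subst k N (M ⊕ M') = subst k N M ⊕ subst k N M'

varHead : Λ → Bool
varHead (var _) = true
varHead (M · _) = varHead M
varHead _ = false

mutual
  L : Λ → Λ
  L (var x) = var x
  L (lam M) = Lλ M
  L (P · Q) = Lh P Q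
  L (M ⊕ N) = L M ⊕ L N

  Lλ : Λ → Λ
  Lλ (var x) = lam (var x)
  Lλ (lam M) = lam (Lλ M)
  Lλ (P · Q) = lam (Lh P Q)
  Lλ (M ⊕ N) = lam M ⊕ lam N

  Lh : Λ → Λ → Λ
  Lh (var x) Q = var x · L Q
  Lh (lam M) Q = subst 0 Q M
  Lh (M ⊕ N) Q = (M · Q) ⊕ (N · Q)
  Lh (P · P') Q = if varHead P then Lh P P' · L Q else Lh P P' · Q

iter : {A : Set} → ℕ → (A → A) → A → A
iter zero f a = a
iter (suc n) f a = f (iter n f a)

infixl 7 _·ₐ_
infixl 6 _⊕ₐ_
data Ap : Set where
  bot  : Ap
  avar : ℕ → Ap
  alam : Ap → Ap
  _·ₐ_ : Ap → Ap → Ap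
  _⊕ₐ_ : Ap → Ap → Ap

ι : Λ → Ap
ι (var x) = avar x
ι (lam M) = alam (ι M)
ι (M · N) = ι M ·ₐ ι N
ι (M ⊕ N) = ι M ⊕ₐ ι N

-- the least preorder with ⊥ ≤ M, compatible with the constructors
infix 4 _≤_
data _≤_ : Ap → Ap → Set where
  bot≤ : ∀ {M} → bot ≤ M
  var≤ : ∀ {x} → avar x ≤ avar x
  lam≤ : ∀ {M N} → M ≤ N → alam M ≤ alam N
  app≤ : ∀ {M M' N N'} → M ≤ M' → N ≤ N' → M ·ₐ N ≤ M' ·ₐ N'
  ⊕≤   : ∀ {M M' N N'} → M ≤ M' → N ≤ N' → M ⊕ₐ N ≤ M' ⊕ₐ N'

mutual
  data 𝒩 : Ap → Set where
    bot𝒩 : 𝒩 bot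
    hnf𝒩 : ∀ {A} → 𝒩λ A → 𝒩 A
    ⊕𝒩   : ∀ {A B} → 𝒩 A → 𝒩 B → 𝒩 (A ⊕ₐ B)

  data 𝒩λ : Ap → Set where
    lam𝒩λ : ∀ {A} → 𝒩λ A → 𝒩λ (alam A)
    sp𝒩λ  : ∀ {A} → 𝒩sp A → 𝒩λ A

  data 𝒩sp : Ap → Set where
    var𝒩sp : ∀ {x} → 𝒩sp (avar x)
    app𝒩sp : ∀ {A B} → 𝒩sp A → 𝒩 B → 𝒩sp (A ·ₐ B)

mutual
  ebtS : Λ → Maybe Ap
  ebtS (var x) = just (avar x)
  ebtS (P · Q) with ebtS P
  ... | just h  = just (h ·ₐ eBT Q)
  ... | nothing = nothing
  ebtS (lam _) = nothing
  ebtS (_ ⊕ _) = nothing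

  ebtL : Λ → Maybe Ap
  ebtL (lam M) with ebtL M
  ... | just h  = just (alam h)
  ... | nothing = nothing
  ebtL (var x) = ebtS (var x)
  ebtL (P · Q) = ebtS (P · Q)
  ebtL (_ ⊕ _) = nothing

  eBT : Λ → Ap
  eBT (M ⊕ N) = eBT M ⊕ₐ eBT N
  eBT (var x) = ebtOr (ebtL (var x))
  eBT (lam M) = ebtOr (ebtL (lam M))
  eBT (P · Q) = ebtOr (ebtL (P · Q))

  ebtOr : Maybe Ap → Ap
  ebtOr (just a) = a
  ebtOr nothing = bot

BT : Λ → Ap → Set
BT M N = 𝒩 N × ∃[ n ] (N ≤ eBT (iter n L M))

-- Resource terms (bags are lists, considered up to permutation via _≈_)

infixl 7 ⟨_⟩_
data RT : Set where
  v    : ℕ → RT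
  ƛ    : RT → RT
  ⟨_⟩_ : RT → List RT → RT
  _⊕•  : RT → RT
  •⊕_  : RT → RT

-- Finite formal sums with coefficients in ℕ are represented as lists
-- (multiplicity = coefficient, order irrelevant); support = membership.
Sum : Set
Sum = List RT

-- equality of resource terms with bags taken as finite multisets
mutual
  infix 4 _≈_ _≈ᵇ_
  data _≈_ : RT → RT → Set where
    v≈   : ∀ {x} → v x ≈ v x
    ƛ≈   : ∀ {s s'} → s ≈ s' → ƛ s ≈ ƛ s'
    app≈ : ∀ {s s' ts ts'} → s ≈ s' → ts ≈ᵇ ts' → ⟨ s ⟩ ts ≈ ⟨ s' ⟩ ts'
    ⊕•≈  : ∀ {s s'} → s ≈ s' → s ⊕• ≈ s' ⊕•
    •⊕≈  : ∀ {s s'} → s ≈ s' → •⊕ s ≈ •⊕ s'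

  data _≈ᵇ_ : List RT → List RT → Set where
    []≈ᵇ : [] ≈ᵇ []
    ∷≈ᵇ  : ∀ {t u ts us₁ us₂} → t ≈ u → ts ≈ᵇ (us₁ ++ us₂) →
           (t ∷ ts) ≈ᵇ (us₁ ++ u ∷ us₂)

mutual
  shiftR : ℕ → RT → RT
  shiftR c (v y) = if y <ᵇ c then v y else v (suc y)
  shiftR c (ƛ s) = ƛ (shiftR (suc c) s)
  shiftR c (⟨ s ⟩ ts) = ⟨ shiftR c s ⟩ shiftB c ts
  shiftR c (s ⊕•) = shiftR c s ⊕•
  shiftR c (•⊕ s) = •⊕ shiftR c s

  shiftB : ℕ → List RT → List RT
  shiftB c [] = []
  shiftB c (t ∷ ts) = shiftR c t ∷ shiftB c ts

splits : {A : Set} → List A → List (List A × List A)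
splits [] = ([] , []) ∷ []
splits (u ∷ us) =
  concatMap (λ p → (u ∷ proj₁ p , proj₂ p) ∷ (proj₁ p , u ∷ proj₂ p) ∷ []) (splits us)

-- ∂ k s ū : symmetric multilinear substitution of ū for the variable k
-- in s, the binder of k being removed (de Bruijn version of ∂ₓ s · ū).
mutual
  ∂ : ℕ → RT → List RT → Sum
  ∂ k (v y) [] = if y ≡ᵇ k then [] else (if y <ᵇ k then v y ∷ [] else v (pred y) ∷ [])
  ∂ k (v y) (u ∷ []) = if y ≡ᵇ k then u ∷ [] else []
  ∂ k (v y) (_ ∷ _ ∷ _) = []
  ∂ k (ƛ s) us = map ƛ (∂ (suc k) s (shiftB 0 us))
  ∂ k (⟨ s ⟩ ts) us =
    concatMap (λ p → concatMap (λ s' → map (λ ts' → ⟨ s' ⟩ ts') (∂B k ts (proj₂ p)))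
                                (∂ k s (proj₁ p)))
              (splits us)
  ∂ k (s ⊕•) us = map _⊕• (∂ k s us)
  ∂ k (•⊕ s) us = map •⊕_ (∂ k s us)

  ∂B : ℕ → List RT → List RT → List (List RT)
  ∂B k [] [] = [] ∷ []
  ∂B k [] (_ ∷ _) = []
  ∂B k (t ∷ ts) us =
    concatMap (λ p → concatMap (λ t' → map (t' ∷_) (∂B k ts (proj₂ p)))
                                (∂ k t (proj₁ p)))
              (splits us)

infix 4 _↦_
data _↦_ : RT → Sum → Set where
  β     : ∀ {s ts} → ⟨ ƛ s ⟩ ts ↦ ∂ 0 s ts
  app⊕• : ∀ {s ts} → ⟨ s ⊕• ⟩ ts ↦ ((⟨ s ⟩ ts) ⊕• ∷ [])
  app•⊕ : ∀ {s ts} → ⟨ •⊕ s ⟩ ts ↦ (•⊕ (⟨ s ⟩ ts) ∷ [])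
  lam⊕• : ∀ {s} → ƛ (s ⊕•) ↦ ((ƛ s) ⊕• ∷ [])
  lam•⊕ : ∀ {s} → ƛ (•⊕ s) ↦ (•⊕ (ƛ s) ∷ [])
  cƛ    : ∀ {s E} → s ↦ E → ƛ s ↦ map ƛ E
  cfun  : ∀ {s ts E} → s ↦ E → ⟨ s ⟩ ts ↦ map (λ s' → ⟨ s' ⟩ ts) E
  carg  : ∀ {s t ts₁ ts₂ E} → t ↦ E →
          ⟨ s ⟩ (ts₁ ++ t ∷ ts₂) ↦ map (λ t' → ⟨ s ⟩ (ts₁ ++ t' ∷ ts₂)) E
  c⊕•   : ∀ {s E} → s ↦ E → s ⊕• ↦ map _⊕• E
  c•⊕   : ∀ {s E} → s ↦ E → •⊕ s ↦ map •⊕_ E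

infix 4 _⇒_
data _⇒_ : Sum → Sum → Set where
  step : ∀ {E₁ e E' E₂} → e ↦ E' → (E₁ ++ e ∷ E₂) ⇒ (E₁ ++ E' ++ E₂)

_⇒*_ : Sum → Sum → Set
_⇒*_ = Star _⇒_

Normal : RT → Set
Normal s = ∀ E → ¬ (s ↦ E)

-- s ∈ supp(NF(e)) : the (unique, by confluence and strong normalisation)
-- normal form of e contains s in its support
InNF : RT → RT → Set
InNF e s = ∃[ F ] ((e ∷ []) ⇒* F) × All Normal F × (s ∈ F)

NF : (RT → Set) → RT → Set
NF E s = ∃[ e ] E e × InNF e s

data 𝒯 : Ap → RT → Set where
  𝒯var : ∀ {x} → 𝒯 (avar x) (v x)
  𝒯lam : ∀ {N t} → 𝒯 N t → 𝒯 (alam N) (ƛ t)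
  𝒯app : ∀ {P Q s ts} → 𝒯 P s → All (𝒯 Q) ts → 𝒯 (P ·ₐ Q) (⟨ s ⟩ ts)
  𝒯⊕•  : ∀ {P Q s} → 𝒯 P s → 𝒯 (P ⊕ₐ Q) (s ⊕•)
  𝒯•⊕  : ∀ {P Q t} → 𝒯 Q t → 𝒯 (P ⊕ₐ Q) (•⊕ t)

𝒯BT : Λ → RT → Set
𝒯BT M s = ∃[ B ] BT M B × 𝒯 B s

𝒯Λ : Λ → RT → Set
𝒯Λ M = 𝒯 (ι M)

-- equality of sets of resource terms (bags being multisets, i.e. up to _≈_)
infix 4 _≐_
_≐_ : (RT → Set) → (RT → Set) → Set
A ≐ B = (∀ s → A s → ∃[ s' ] B s' × s ≈ s') × (∀ s → B s → ∃[ s' ] A s' × s ≈ s')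

{-# OPTIONS --safe #-}
-- A resource reduct of an element of 𝒯(M) need not lie in 𝒯 of a reduct of M, since
-- it may reduce only one copy of a duplicated argument.  The relation M ⊩ s
-- repairs this: M may head reduce, choosing a branch whenever a sum comes to
-- head position, before each constructor of s is matched.  It contains 𝒯(M),
-- is closed under ↦, and for normal s the head reductions it uses can be
-- rearranged into the order followed by L, so that s ∈ 𝒯(eBT(Lⁿ M)) for some n.
-- Conversely every element of 𝒯(L M) is a summand of a reduct of an element of
-- 𝒯(M); weak normalisation of resource terms then normalises the other
-- summands.  Coefficients lie in ℕ, so nothing cancels, confluence is not
-- needed, and the two sides agree on the nose rather than up to ≈.
module Submission where

open import Defs
open import Data.Bool using (true; false)
open import Data.Empty using (⊥-elim)
open import Data.List using (List; []; _∷_; _++_; concatMap; map)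
open import Data.List.Membership.Propositional using (_∈_; find; lose)
open import Data.List.Membership.Propositional.Properties
  using (∈-map⁺; ∈-map⁻; ∈-concatMap⁺; ∈-concatMap⁻; ∈-∃++; ∈-++⁺ˡ; ∈-++⁺ʳ)
open import Data.List.Properties using (++-assoc; ++-identityʳ)
open import Data.List.Relation.Binary.Permutation.Propositional
  using (_↭_; refl; prep; swap; trans; ↭-sym)
import Data.List.Relation.Binary.Permutation.Propositional.Properties as Perm
open import Data.List.Relation.Binary.Pointwise using (Pointwise; []; _∷_)
open import Data.List.Relation.Unary.All as All using (All; []; _∷_)
import Data.List.Relation.Unary.All.Properties as Allₚ
open import Data.List.Relation.Unary.Any using (here; there)
open import Data.Maybe using (just; nothing)
open import Data.Nat using (ℕ; zero; suc; _+_; _*_; _<_; _<ᵇ_; _≡ᵇ_; pred; s≤s)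
  renaming (_≤_ to _≤ℕ_)
open import Data.Nat.Induction using (<-wellFounded)
open import Data.Nat.Properties
  using (+-assoc; +-comm; +-commutativeSemigroup; +-mono-≤; +-monoˡ-≤; +-monoˡ-<;
         +-monoʳ-<; *-suc; *-monoʳ-<; ≤-refl; ≤-reflexive; ≤-trans; m≤m+n; n≤1+n; module ≤-Reasoning)
open import Data.Product using (∃₂; ∃-syntax; _×_; _,_; proj₁; proj₂)
open import Data.Product.Relation.Binary.Lex.Strict using (×-Lex; ×-wellFounded)
open import Data.Sum using (_⊎_; inj₁; inj₂)
open import Function using (_∘_)
open import Induction.WellFounded using (Acc; acc; WellFounded)
import Relation.Binary.Construct.On as On
open import Relation.Binary.Construct.Closure.ReflexiveTransitive
  using (Star; ε; _◅_; _◅◅_; gmap)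
open import Relation.Binary.PropositionalEquality as ≡
  using (_≡_; refl; sym; cong; cong₂; module ≡-Reasoning)
open import Relation.Nullary using (¬_)
open import Algebra.Properties.CommutativeSemigroup +-commutativeSemigroup using (interchange)

-- Substitution calculus

-- Structural recursion replaces the Boolean test in `shift`, so that passing under a binder holds
-- by computation.
shiftVar : ℕ → ℕ → ℕ
shiftVar zero    y       = suc y
shiftVar (suc c) zero    = zero
shiftVar (suc c) (suc y) = suc (shiftVar c y)

liftᵣ : (ℕ → ℕ) → ℕ → ℕ
liftᵣ ρ zero    = zero
liftᵣ ρ (suc y) = suc (ρ y)

ren : (ℕ → ℕ) → Λ → Λ
ren ρ (var y) = var (ρ y)
ren ρ (lam M) = lam (ren (liftᵣ ρ) M)
ren ρ (M · N) = ren ρ M · ren ρ N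
ren ρ (M ⊕ N) = ren ρ M ⊕ ren ρ N

lift : (ℕ → Λ) → ℕ → Λ
lift σ zero    = var zero
lift σ (suc y) = ren suc (σ y)

-- Parallel substitution. Both `shift` and `subst` turn out to be instances, so commutation of
-- substitutions follows from the composition law `sub-sub` instead of an induction with index
-- arithmetic.
sub : (ℕ → Λ) → Λ → Λ
sub σ (var y) = σ y
sub σ (lam M) = lam (sub (lift σ) M)
sub σ (M · N) = sub σ M · sub σ N
sub σ (M ⊕ N) = sub σ M ⊕ sub σ N

infix 4 _≗_
_≗_ : (σ τ : ℕ → Λ) → Set
σ ≗ τ = ∀ y → σ y ≡ τ y

lift-cong : ∀ {σ τ} → σ ≗ τ → lift σ ≗ lift τ
lift-cong eq zero    = refl
lift-cong eq (suc y) = cong (ren suc) (eq y)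

sub-cong : ∀ {σ τ} → σ ≗ τ → ∀ M → sub σ M ≡ sub τ M
sub-cong eq (var y) = eq y
sub-cong eq (lam M) = cong lam (sub-cong (lift-cong eq) M)
sub-cong eq (M · N) = cong₂ _·_ (sub-cong eq M) (sub-cong eq N)
sub-cong eq (M ⊕ N) = cong₂ _⊕_ (sub-cong eq M) (sub-cong eq N)

lift-var : lift var ≗ var
lift-var zero    = refl
lift-var (suc y) = refl

sub-var : ∀ M → sub var M ≡ M
sub-var (var y) = refl
sub-var (lam M) = cong lam (≡.trans (sub-cong lift-var M) (sub-var M))
sub-var (M · N) = cong₂ _·_ (sub-var M) (sub-var N)
sub-var (M ⊕ N) = cong₂ _⊕_ (sub-var M) (sub-var N)

lift-liftᵣ : ∀ σ ρ → lift (σ ∘ ρ) ≗ lift σ ∘ liftᵣ ρ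
lift-liftᵣ σ ρ zero    = refl
lift-liftᵣ σ ρ (suc y) = refl

sub-ren : ∀ σ ρ M → sub σ (ren ρ M) ≡ sub (σ ∘ ρ) M
sub-ren σ ρ (var y) = refl
sub-ren σ ρ (lam M) = cong lam (≡.trans (sub-ren (lift σ) (liftᵣ ρ) M)
                                        (sym (sub-cong (lift-liftᵣ σ ρ) M)))
sub-ren σ ρ (M · N) = cong₂ _·_ (sub-ren σ ρ M) (sub-ren σ ρ N)
sub-ren σ ρ (M ⊕ N) = cong₂ _⊕_ (sub-ren σ ρ M) (sub-ren σ ρ N)

lift-var∘ : ∀ ρ → lift (var ∘ ρ) ≗ var ∘ liftᵣ ρ
lift-var∘ ρ zero    = refl
lift-var∘ ρ (suc y) = refl

ren≡sub : ∀ ρ M → ren ρ M ≡ sub (var ∘ ρ) M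
ren≡sub ρ (var y) = refl
ren≡sub ρ (lam M) = cong lam (≡.trans (ren≡sub (liftᵣ ρ) M)
                                      (sym (sub-cong (lift-var∘ ρ) M)))
ren≡sub ρ (M · N) = cong₂ _·_ (ren≡sub ρ M) (ren≡sub ρ N)
ren≡sub ρ (M ⊕ N) = cong₂ _⊕_ (ren≡sub ρ M) (ren≡sub ρ N)

ren-ren : ∀ ρ ρ' M → ren ρ (ren ρ' M) ≡ ren (ρ ∘ ρ') M
ren-ren ρ ρ' M = begin
  ren ρ (ren ρ' M)         ≡⟨ ren≡sub ρ (ren ρ' M) ⟩
  sub (var ∘ ρ) (ren ρ' M) ≡⟨ sub-ren (var ∘ ρ) ρ' M ⟩
  sub (var ∘ ρ ∘ ρ') M     ≡⟨ ren≡sub (ρ ∘ ρ') M ⟨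
  ren (ρ ∘ ρ') M           ∎
  where open ≡-Reasoning

ren-lift : ∀ ρ σ → lift (ren ρ ∘ σ) ≗ ren (liftᵣ ρ) ∘ lift σ
ren-lift ρ σ zero    = refl
ren-lift ρ σ (suc y) = ≡.trans (ren-ren suc ρ (σ y)) (sym (ren-ren (liftᵣ ρ) suc (σ y)))

ren-sub : ∀ ρ σ M → ren ρ (sub σ M) ≡ sub (ren ρ ∘ σ) M
ren-sub ρ σ (var y) = refl
ren-sub ρ σ (lam M) = cong lam (≡.trans (ren-sub (liftᵣ ρ) (lift σ) M)
                                        (sym (sub-cong (ren-lift ρ σ) M)))
ren-sub ρ σ (M · N) = cong₂ _·_ (ren-sub ρ σ M) (ren-sub ρ σ N)
ren-sub ρ σ (M ⊕ N) = cong₂ _⊕_ (ren-sub ρ σ M) (ren-sub ρ σ N)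

-- At a successor this needs both mixed laws, `ren-sub` and `sub-ren`, which is why compositions
-- with renamings come first.
sub-lift : ∀ σ τ → lift (sub σ ∘ τ) ≗ sub (lift σ) ∘ lift τ
sub-lift σ τ zero    = refl
sub-lift σ τ (suc y) = ≡.trans (ren-sub suc σ (τ y)) (sym (sub-ren (lift σ) suc (τ y)))

sub-sub : ∀ σ τ M → sub σ (sub τ M) ≡ sub (sub σ ∘ τ) M
sub-sub σ τ (var y) = refl
sub-sub σ τ (lam M) = cong lam (≡.trans (sub-sub (lift σ) (lift τ) M)
                                        (sym (sub-cong (sub-lift σ τ) M)))
sub-sub σ τ (M · N) = cong₂ _·_ (sub-sub σ τ M) (sub-sub σ τ N)
sub-sub σ τ (M ⊕ N) = cong₂ _⊕_ (sub-sub σ τ M) (sub-sub σ τ N)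

shift-shiftVar : ∀ c y → shift c (var y) ≡ var (shiftVar c y)
shift-shiftVar zero    y       = refl
shift-shiftVar (suc c) zero    = refl
shift-shiftVar (suc c) (suc y) with y <ᵇ c | shift-shiftVar c y
... | true  | eq = cong (shift 0) eq
... | false | eq = cong (shift 0) eq

shift≡sub : ∀ c M → shift c M ≡ sub (var ∘ shiftVar c) M
shift≡sub c (var y) = shift-shiftVar c y
shift≡sub c (lam M) = cong lam (≡.trans (shift≡sub (suc c) M) (sub-cong lift-shiftVar M))
  where
  lift-shiftVar : var ∘ shiftVar (suc c) ≗ lift (var ∘ shiftVar c)
  lift-shiftVar zero    = refl
  lift-shiftVar (suc y) = refl
shift≡sub c (M · N) = cong₂ _·_ (shift≡sub c M) (shift≡sub c N)
shift≡sub c (M ⊕ N) = cong₂ _⊕_ (shift≡sub c M) (shift≡sub c N)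

shift₀≡ren : ∀ M → shift 0 M ≡ ren suc M
shift₀≡ren M = ≡.trans (shift≡sub 0 M) (sym (ren≡sub suc M))

-- Defined through `subst` itself so that the variable case of `subst≡sub` is `refl`.
single : ℕ → Λ → ℕ → Λ
single k N y = subst k N (var y)

single-suc : ∀ k N → single (suc k) (shift 0 N) ≗ lift (single k N)
single-suc k N zero    = refl
single-suc k N (suc y) = ≡.trans (at k y) (shift₀≡ren (single k N y))
  where
  at : ∀ k y → single (suc k) (shift 0 N) (suc y) ≡ shift 0 (single k N y)
  -- Splitting off the zero cases leaves `pred` applied to a visible successor wherever it is
  -- evaluated, so both sides compute.
  at zero    zero    = refl
  at zero    (suc y) = refl
  at (suc k) zero    = refl
  at (suc k) (suc y) with y ≡ᵇ k | y <ᵇ k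
  ... | true  | _     = refl
  ... | false | true  = refl
  ... | false | false = refl

subst≡sub : ∀ k N M → subst k N M ≡ sub (single k N) M
subst≡sub k N (var y)  = refl
subst≡sub k N (lam M)  = cong lam (≡.trans (subst≡sub (suc k) (shift 0 N) M)
                                           (sub-cong (single-suc k N) M))
subst≡sub k N (M · M') = cong₂ _·_ (subst≡sub k N M) (subst≡sub k N M')
subst≡sub k N (M ⊕ M') = cong₂ _⊕_ (subst≡sub k N M) (subst≡sub k N M')

-- Once both sides are fused into one parallel substitution, only variables remain: index 0 gives
-- `sub σ Q` on both sides, and above it the renaming by `suc` inside `lift σ` cancels the decrement
-- of `single 0`.
sub-subst : ∀ σ Q M → sub σ (subst 0 Q M) ≡ subst 0 (sub σ Q) (sub (lift σ) M)
sub-subst σ Q M = begin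
  sub σ (subst 0 Q M)                      ≡⟨ cong (sub σ) (subst≡sub 0 Q M) ⟩
  sub σ (sub (single 0 Q) M)               ≡⟨ sub-sub σ (single 0 Q) M ⟩
  sub (sub σ ∘ single 0 Q) M               ≡⟨ sub-cong pointwise M ⟩
  sub (sub (single 0 (sub σ Q)) ∘ lift σ) M ≡⟨ sub-sub _ (lift σ) M ⟨
  sub (single 0 (sub σ Q)) (sub (lift σ) M) ≡⟨ subst≡sub 0 (sub σ Q) (sub (lift σ) M) ⟨
  subst 0 (sub σ Q) (sub (lift σ) M)       ∎
  where
  open ≡-Reasoning
  pointwise : sub σ ∘ single 0 Q ≗ sub (single 0 (sub σ Q)) ∘ lift σ
  pointwise zero    = refl
  pointwise (suc y) = sym (≡.trans (sub-ren _ suc (σ y)) (sub-var (σ y)))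

-- Labelled head reduction

data Label : Set where
  silent left right : Label

act : Label → RT → RT
act silent s = s
act left   s = s ⊕•
act right  s = •⊕ s

infix 4 _⟿[_]_
-- Since `⟿app` accepts a `⟿lam` step, the body of an applied abstraction may reduce too. Such steps
-- arise when a resource sum leaves first an abstraction and then an application.
data _⟿[_]_ : Λ → Label → Λ → Set where
  ⟿β     : ∀ {M Q} → lam M · Q ⟿[ silent ] subst 0 Q M
  ⟿left  : ∀ {A B} → A ⊕ B ⟿[ left ] A
  ⟿right : ∀ {A B} → A ⊕ B ⟿[ right ] B
  ⟿lam   : ∀ {a M M'} → M ⟿[ a ] M' → lam M ⟿[ a ] lam M'
  ⟿app   : ∀ {a P P' Q} → P ⟿[ a ] P' → P · Q ⟿[ a ] P' · Q

⟿-sub : ∀ {a M M'} σ → M ⟿[ a ] M' → sub σ M ⟿[ a ] sub σ M'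
⟿-sub σ (⟿β {M} {Q}) rewrite sub-subst σ Q M = ⟿β
⟿-sub σ ⟿left    = ⟿left
⟿-sub σ ⟿right   = ⟿right
⟿-sub σ (⟿lam r) = ⟿lam (⟿-sub (lift σ) r)
⟿-sub σ (⟿app r) = ⟿app (⟿-sub σ r)

⟿-shift : ∀ {a M M'} c → M ⟿[ a ] M' → shift c M ⟿[ a ] shift c M'
⟿-shift {M = M} {M'} c r rewrite shift≡sub c M | shift≡sub c M' = ⟿-sub _ r

⟿-subst : ∀ {a M M'} k N → M ⟿[ a ] M' → subst k N M ⟿[ a ] subst k N M'
⟿-subst {M = M} {M'} k N r rewrite subst≡sub k N M | subst≡sub k N M' = ⟿-sub _ r

infix 4 _⊩_
-- The entries of a bag are related to `Q` independently, so different copies of an argument may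
-- stand at different stages of reduction.
data _⊩_ : Λ → RT → Set where
  ⊩var   : ∀ {x} → var x ⊩ v x
  ⊩lam   : ∀ {M s} → M ⊩ s → lam M ⊩ ƛ s
  ⊩app   : ∀ {P Q s ts} → P ⊩ s → All (Q ⊩_) ts → P · Q ⊩ ⟨ s ⟩ ts
  ⊩step  : ∀ {M M' s} → M ⟿[ silent ] M' → M' ⊩ s → M ⊩ s
  ⊩left  : ∀ {M M' s} → M ⟿[ left ] M' → M' ⊩ s → M ⊩ s ⊕•
  ⊩right : ∀ {M M' s} → M ⟿[ right ] M' → M' ⊩ s → M ⊩ •⊕ s

mutual
  𝒯⇒⊩ : ∀ M {s} → 𝒯Λ M s → M ⊩ s
  𝒯⇒⊩ (var x) 𝒯var        = ⊩var
  𝒯⇒⊩ (lam M) (𝒯lam p)    = ⊩lam (𝒯⇒⊩ M p)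
  𝒯⇒⊩ (P · Q) (𝒯app p qs) = ⊩app (𝒯⇒⊩ P p) (All𝒯⇒⊩ Q qs)
  𝒯⇒⊩ (A ⊕ B) (𝒯⊕• p)     = ⊩left ⟿left (𝒯⇒⊩ A p)
  𝒯⇒⊩ (A ⊕ B) (𝒯•⊕ p)     = ⊩right ⟿right (𝒯⇒⊩ B p)

  All𝒯⇒⊩ : ∀ Q {ts} → All (𝒯Λ Q) ts → All (Q ⊩_) ts
  All𝒯⇒⊩ Q []       = []
  All𝒯⇒⊩ Q (q ∷ qs) = 𝒯⇒⊩ Q q ∷ All𝒯⇒⊩ Q qs

mutual
  ⊩-shift : ∀ {M s} c → M ⊩ s → shift c M ⊩ shiftR c s
  ⊩-shift c (⊩var {x}) with x <ᵇ c
  ... | true  = ⊩var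
  ... | false = ⊩var
  ⊩-shift c (⊩lam p)     = ⊩lam (⊩-shift (suc c) p)
  ⊩-shift c (⊩app p qs)  = ⊩app (⊩-shift c p) (All⊩-shift c qs)
  ⊩-shift c (⊩step r p)  = ⊩step (⟿-shift c r) (⊩-shift c p)
  ⊩-shift c (⊩left r p)  = ⊩left (⟿-shift c r) (⊩-shift c p)
  ⊩-shift c (⊩right r p) = ⊩right (⟿-shift c r) (⊩-shift c p)

  All⊩-shift : ∀ {M ts} c → All (M ⊩_) ts → All (shift c M ⊩_) (shiftB c ts)
  All⊩-shift c []       = []
  All⊩-shift c (q ∷ qs) = ⊩-shift c q ∷ All⊩-shift c qs

-- Splittings of bags

module _ {A B : Set} where

  ∈-concatMap⇒∃ : ∀ {f : A → List B} xs {y} → y ∈ concatMap f xs → ∃[ x ] x ∈ xs × y ∈ f x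
  ∈-concatMap⇒∃ {f} xs y∈ = find (∈-concatMap⁻ f {xs = xs} y∈)

  ∃⇒∈-concatMap : ∀ {f : A → List B} {xs x y} → x ∈ xs → y ∈ f x → y ∈ concatMap f xs
  ∃⇒∈-concatMap {f} x∈ y∈ = ∈-concatMap⁺ f (lose x∈ y∈)

-- An entry sent to the right half has to cross the whole left half, hence a permutation rather than
-- an equality.
splits-↭ : ∀ {A : Set} (us : List A) {vs ws} → (vs , ws) ∈ splits us → us ↭ vs ++ ws
splits-↭ []       (here refl) = refl
splits-↭ (u ∷ us) p∈ with ∈-concatMap⇒∃ (splits us) p∈
... | (vs , ws) , q∈ , here refl         = prep u (splits-↭ us q∈)
... | (vs , ws) , q∈ , there (here refl) =
  trans (prep u (splits-↭ us q∈)) (↭-sym (Perm.shift u vs ws))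

-- When a substitution is undone, the argument bag is assembled as a concatenation; this recovers
-- its two parts.
++∈splits : ∀ {A : Set} (us vs : List A) → (us , vs) ∈ splits (us ++ vs)
++∈splits []       []       = here refl
++∈splits []       (w ∷ vs) = ∃⇒∈-concatMap (++∈splits [] vs) (there (here refl))
++∈splits (u ∷ us) vs       = ∃⇒∈-concatMap (++∈splits us vs) (here refl)

module _ {U A B C : Set} (g : A → B → C) (F : List U → List A) (G : List U → List B) where

  -- The common shape of `∂` on an application and `∂B` on a nonempty bag; both unfold to it
  -- definitionally.
  convolve : List U → List C
  convolve us =
    concatMap (λ p → concatMap (λ a → map (g a) (G (proj₂ p))) (F (proj₁ p))) (splits us)

  ∈-convolve⁻ : ∀ us {c} → c ∈ convolve us →
    ∃₂ λ vs ws → us ↭ vs ++ ws × ∃₂ λ a b → a ∈ F vs × b ∈ G ws × c ≡ g a b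
  ∈-convolve⁻ us c∈ with ∈-concatMap⇒∃ (splits us) c∈
  ... | (vs , ws) , p∈ , c∈′ with ∈-concatMap⇒∃ (F vs) c∈′
  ... | a , a∈ , c∈″ with ∈-map⁻ (g a) c∈″
  ... | b , b∈ , eq = vs , ws , splits-↭ us p∈ , a , b , a∈ , b∈ , eq

  ∈-convolve⁺ : ∀ vs ws {a b} → a ∈ F vs → b ∈ G ws → g a b ∈ convolve (vs ++ ws)
  ∈-convolve⁺ vs ws a∈ b∈ =
    ∃⇒∈-concatMap (++∈splits vs ws) (∃⇒∈-concatMap a∈ (∈-map⁺ (g _) b∈))

All-split : ∀ {A : Set} {P : A → Set} {us : List A} vs {ws} →
            us ↭ vs ++ ws → All P us → All P vs × All P ws
All-split vs us↭ ps = Allₚ.++⁻ vs (Perm.All-resp-↭ us↭ ps)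

-- Subject reduction for ⊩

mutual
  -- By induction on `M ⊩ s`: head steps of `M` survive substitution by `⟿-subst`, and each
  -- splitting hands the subterms subbags whose entries are still related to `N`.
  ⊩-∂ : ∀ {M s N us r} k → M ⊩ s → All (N ⊩_) us → r ∈ ∂ k s us → subst k N M ⊩ r
  ⊩-∂ {us = []} k (⊩var {x}) [] r∈ with x ≡ᵇ k
  ⊩-∂ {us = []} k (⊩var {x}) [] () | true
  ... | false with x <ᵇ k
  ⊩-∂ {us = []} k (⊩var {x}) [] (here refl) | false | true  = ⊩var
  ⊩-∂ {us = []} k (⊩var {x}) [] (here refl) | false | false = ⊩var
  ⊩-∂ {us = u ∷ []} k (⊩var {x}) (n ∷ []) r∈ with x ≡ᵇ k
  ⊩-∂ {us = u ∷ []} k (⊩var {x}) (n ∷ []) (here refl) | true  = n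
  ⊩-∂ {us = u ∷ []} k (⊩var {x}) (n ∷ []) ()          | false
  ⊩-∂ {us = u ∷ u' ∷ us} k ⊩var ns ()
  ⊩-∂ k (⊩lam p) ns r∈ with ∈-map⁻ ƛ r∈
  ... | _ , r'∈ , refl = ⊩lam (⊩-∂ (suc k) p (All⊩-shift 0 ns) r'∈)
  ⊩-∂ {us = us} k (⊩app {s = s} {ts} p qs) ns r∈
    with ∈-convolve⁻ ⟨_⟩_ (∂ k s) (∂B k ts) us r∈
  ... | vs , ws , us↭ , _ , _ , s'∈ , ts'∈ , refl with All-split vs us↭ ns
  ... | ns₁ , ns₂ = ⊩app (⊩-∂ k p ns₁ s'∈) (All⊩-∂B k qs ns₂ ts'∈)
  ⊩-∂ k (⊩step h p) ns r∈ = ⊩step (⟿-subst k _ h) (⊩-∂ k p ns r∈)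
  ⊩-∂ k (⊩left h p) ns r∈ with ∈-map⁻ _⊕• r∈
  ... | _ , r'∈ , refl = ⊩left (⟿-subst k _ h) (⊩-∂ k p ns r'∈)
  ⊩-∂ k (⊩right h p) ns r∈ with ∈-map⁻ •⊕_ r∈
  ... | _ , r'∈ , refl = ⊩right (⟿-subst k _ h) (⊩-∂ k p ns r'∈)

  All⊩-∂B : ∀ {M ts N us rs} k → All (M ⊩_) ts → All (N ⊩_) us → rs ∈ ∂B k ts us →
            All (subst k N M ⊩_) rs
  All⊩-∂B {us = []}    k [] ns (here refl) = []
  All⊩-∂B {us = _ ∷ _} k [] ns ()
  All⊩-∂B {ts = t ∷ ts} {us = us} k (q ∷ qs) ns r∈
    with ∈-convolve⁻ _∷_ (∂ k t) (∂B k ts) us r∈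
  ... | vs , ws , us↭ , _ , _ , t'∈ , ts'∈ , refl with All-split vs us↭ ns
  ... | ns₁ , ns₂ = ⊩-∂ k q ns₁ t'∈ ∷ All⊩-∂B k qs ns₂ ts'∈

-- The derivation for `P` may begin with silent steps; they are replayed under the application until
-- an actual abstraction is exposed.
⊩-β : ∀ {P Q s ts r} → P ⊩ ƛ s → All (Q ⊩_) ts → r ∈ ∂ 0 s ts → P · Q ⊩ r
⊩-β (⊩lam p)    qs r∈ = ⊩step ⟿β (⊩-∂ 0 p qs r∈)
⊩-β (⊩step h p) qs r∈ = ⊩step (⟿app h) (⊩-β p qs r∈)

-- The branch chosen inside `P` can equally be chosen by `P · Q`, through `⟿app`. So moving the
-- resource sum outwards only moves the place where the label is recorded.
⊩-app⊕• : ∀ {P Q s ts} → P ⊩ s ⊕• → All (Q ⊩_) ts → P · Q ⊩ (⟨ s ⟩ ts) ⊕•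
⊩-app⊕• (⊩step h p) qs = ⊩step (⟿app h) (⊩-app⊕• p qs)
⊩-app⊕• (⊩left h p) qs = ⊩left (⟿app h) (⊩app p qs)

⊩-app•⊕ : ∀ {P Q s ts} → P ⊩ •⊕ s → All (Q ⊩_) ts → P · Q ⊩ •⊕ (⟨ s ⟩ ts)
⊩-app•⊕ (⊩step h p)  qs = ⊩step (⟿app h) (⊩-app•⊕ p qs)
⊩-app•⊕ (⊩right h p) qs = ⊩right (⟿app h) (⊩app p qs)

⊩-lam⊕• : ∀ {M s} → M ⊩ s ⊕• → lam M ⊩ (ƛ s) ⊕•
⊩-lam⊕• (⊩step h p) = ⊩step (⟿lam h) (⊩-lam⊕• p)
⊩-lam⊕• (⊩left h p) = ⊩left (⟿lam h) (⊩lam p)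

⊩-lam•⊕ : ∀ {M s} → M ⊩ •⊕ s → lam M ⊩ •⊕ (ƛ s)
⊩-lam•⊕ (⊩step h p)  = ⊩step (⟿lam h) (⊩-lam•⊕ p)
⊩-lam•⊕ (⊩right h p) = ⊩right (⟿lam h) (⊩lam p)

mutual
  -- Silent steps leave the resource term untouched and are peeled off first. Each remaining rule of
  -- `_⊩_` then matches a constructor of `e`.
  ⊩-↦ : ∀ {M e E e'} → M ⊩ e → e ↦ E → e' ∈ E → M ⊩ e'
  ⊩-↦ (⊩step h p) r e'∈ = ⊩step h (⊩-↦ p r e'∈)
  ⊩-↦ (⊩lam p) lam⊕• (here refl) = ⊩-lam⊕• p
  ⊩-↦ (⊩lam p) lam•⊕ (here refl) = ⊩-lam•⊕ p
  ⊩-↦ (⊩lam p) (cƛ r) e'∈ with ∈-map⁻ ƛ e'∈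
  ... | _ , s'∈ , refl = ⊩lam (⊩-↦ p r s'∈)
  ⊩-↦ (⊩app p qs) β     e'∈         = ⊩-β p qs e'∈
  ⊩-↦ (⊩app p qs) app⊕• (here refl) = ⊩-app⊕• p qs
  ⊩-↦ (⊩app p qs) app•⊕ (here refl) = ⊩-app•⊕ p qs
  ⊩-↦ (⊩app p qs) (cfun r) e'∈ with ∈-map⁻ _ e'∈
  ... | _ , s'∈ , refl = ⊩app (⊩-↦ p r s'∈) qs
  ⊩-↦ (⊩app p qs) (carg {ts₁ = ts₁} r) e'∈ with ∈-map⁻ _ e'∈
  ... | _ , t'∈ , refl = ⊩app p (All⊩-↦ ts₁ qs r t'∈)
  ⊩-↦ (⊩left h p) (c⊕• r) e'∈ with ∈-map⁻ _⊕• e'∈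
  ... | _ , s'∈ , refl = ⊩left h (⊩-↦ p r s'∈)
  ⊩-↦ (⊩right h p) (c•⊕ r) e'∈ with ∈-map⁻ •⊕_ e'∈
  ... | _ , s'∈ , refl = ⊩right h (⊩-↦ p r s'∈)

  All⊩-↦ : ∀ {Q t E t'} ts₁ {ts₂} → All (Q ⊩_) (ts₁ ++ t ∷ ts₂) → t ↦ E → t' ∈ E →
           All (Q ⊩_) (ts₁ ++ t' ∷ ts₂)
  All⊩-↦ []        (q ∷ qs) r t'∈ = ⊩-↦ q r t'∈ ∷ qs
  All⊩-↦ (_ ∷ ts₁) (q ∷ qs) r t'∈ = q ∷ All⊩-↦ ts₁ qs r t'∈

⊩-⇒* : ∀ {M E F} → E ⇒* F → All (M ⊩_) E → All (M ⊩_) F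
⊩-⇒* ε                    ps = ps
⊩-⇒* (step {E₁} r ◅ rs) ps with Allₚ.++⁻ E₁ ps
... | ps₁ , p ∷ ps₂ =
  ⊩-⇒* rs (Allₚ.++⁺ ps₁ (Allₚ.++⁺ (All.tabulate (⊩-↦ p r)) ps₂))

-- Standardisation: reaching normal forms by iterating L

mutual
  -- `Spine`, `Hnf` and `Nf` ask for normality only along the paths visited by the resource term:
  -- the other branch of a sum, and an argument matched with the empty bag, are arbitrary.
  data Spine : Λ → RT → Set where
    var : ∀ {x} → Spine (var x) (v x)
    app : ∀ {P Q s ts} → Spine P s → All (Nf Q) ts → Spine (P · Q) (⟨ s ⟩ ts)

  data Hnf : Λ → RT → Set where
    spine : ∀ {M s} → Spine M s → Hnf M s
    lam   : ∀ {M s} → Hnf M s → Hnf (lam M) (ƛ s)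

  data Nf : Λ → RT → Set where
    hnf   : ∀ {M s} → Hnf M s → Nf M s
    left  : ∀ {A B s} → Nf A s → Nf (A ⊕ B) (s ⊕•)
    right : ∀ {A B s} → Nf B s → Nf (A ⊕ B) (•⊕ s)

Spine⇒varHead : ∀ {P s} → Spine P s → varHead P ≡ true
Spine⇒varHead var       = refl
Spine⇒varHead (app p _) = Spine⇒varHead p

L-varHead : ∀ P Q → varHead P ≡ true → L (P · Q) ≡ L P · L Q
L-varHead (var x)   Q eq = refl
L-varHead (P · P') Q eq rewrite eq = refl

L-neutral : ∀ P P' Q → varHead P ≡ false → L (P · P' · Q) ≡ L (P · P') · Q
L-neutral P P' Q eq rewrite eq = refl

mutual
  Spine-L : ∀ {M s} → Spine M s → Spine (L M) s
  Spine-L var = var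
  Spine-L (app {P} {Q} p qs) rewrite L-varHead P Q (Spine⇒varHead p) =
    app (Spine-L p) (AllNf-L qs)

  Hnf-Lλ : ∀ {M s} → Hnf M s → Hnf (Lλ M) (ƛ s)
  Hnf-Lλ (spine var)          = lam (spine var)
  Hnf-Lλ (spine p@(app _ _)) = lam (spine (Spine-L p))
  Hnf-Lλ (lam h)              = lam (Hnf-Lλ h)

  -- This stability lets entries of a bag that become normal after different numbers of rounds of
  -- `L` be brought to a common number.
  Nf-L : ∀ {M s} → Nf M s → Nf (L M) s
  Nf-L (hnf (spine p)) = hnf (spine (Spine-L p))
  Nf-L (hnf (lam h))   = hnf (Hnf-Lλ h)
  Nf-L (left p)        = left (Nf-L p)
  Nf-L (right p)       = right (Nf-L p)

  AllNf-L : ∀ {Q ts} → All (Nf Q) ts → All (Nf (L Q)) ts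
  AllNf-L []       = []
  AllNf-L (q ∷ qs) = Nf-L q ∷ AllNf-L qs

infix 4 _⇓_
-- An inductive form of `∃[ n ] Nf (iter n L M) s`, providing a derivation to recurse on. Here
-- `later` peels `L` off at the inside whereas `iter` adds it at the outside, hence `iter-shift`.
data _⇓_ : Λ → RT → Set where
  now   : ∀ {M s} → Nf M s → M ⇓ s
  later : ∀ {M s} → L M ⇓ s → M ⇓ s

iter-shift : ∀ {A : Set} n (f : A → A) a → iter n f (f a) ≡ f (iter n f a)
iter-shift zero    f a = refl
iter-shift (suc n) f a = cong f (iter-shift n f a)

iter-+ : ∀ {A : Set} m n (f : A → A) a → iter (m + n) f a ≡ iter m f (iter n f a)
iter-+ zero    n f a = refl
iter-+ (suc m) n f a = cong f (iter-+ m n f a)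

⇓⇒iter : ∀ {M s} → M ⇓ s → ∃[ n ] Nf (iter n L M) s
⇓⇒iter (now p) = 0 , p
⇓⇒iter {M} {s} (later d) with ⇓⇒iter d
... | n , p = suc n , ≡.subst (λ N → Nf N s) (iter-shift n L M) p

Nf-iter : ∀ {M s} n → Nf M s → Nf (iter n L M) s
Nf-iter zero    p = p
Nf-iter (suc n) p = Nf-L (Nf-iter n p)

Nf-iter-+ : ∀ {M s} m n → Nf (iter n L M) s → Nf (iter (m + n) L M) s
Nf-iter-+ {M} {s} m n p = ≡.subst (λ N → Nf N s) (sym (iter-+ m n L M)) (Nf-iter m p)

All⇓⇒iter : ∀ {Q ts} → All (Q ⇓_) ts → ∃[ n ] All (Nf (iter n L Q)) ts
All⇓⇒iter [] = 0 , []
All⇓⇒iter {Q} {t ∷ _} (d ∷ ds) with ⇓⇒iter d | All⇓⇒iter ds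
... | m , p | n , ps =
  -- The sum of the two counts serves the first entry and the rest alike, because further rounds
  -- preserve `Nf`.
  m + n , ≡.subst (λ k → Nf (iter k L Q) t) (+-comm n m) (Nf-iter-+ n m p)
        ∷ All.map (Nf-iter-+ m n) ps

data Sum⊕ : RT → Set where
  left  : ∀ {s} → Sum⊕ (s ⊕•)
  right : ∀ {s} → Sum⊕ (•⊕ s)

-- The shapes that form a redex in function position; those of `Sum⊕` form one directly under an
-- abstraction as well.
data Abs⊕ : RT → Set where
  abs : ∀ {s} → Abs⊕ (ƛ s)
  sum : ∀ {s} → Sum⊕ s → Abs⊕ s

⇓-sum : ∀ {A B s} → A ⊕ B ⇓ s → Sum⊕ s
⇓-sum (now (left _))         = left
⇓-sum (now (right _))        = right
⇓-sum (now (hnf (spine ())))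
⇓-sum (later d)              = ⇓-sum d

L-lam : ∀ M → (∃₂ λ A B → M ≡ A ⊕ B) ⊎ (L (lam M) ≡ lam (L M))
L-lam (var x) = inj₂ refl
L-lam (lam M) = inj₂ refl
L-lam (P · Q) = inj₂ refl
L-lam (A ⊕ B) = inj₁ (A , B , refl)

⇓-abs : ∀ {M s} → lam M ⇓ s → Abs⊕ s
⇓-abs (now (hnf (spine ())))
⇓-abs (now (hnf (lam h))) = abs
⇓-abs {M} (later d) with L-lam M
... | inj₁ (A , B , refl) = sum (⇓-sum d)
... | inj₂ eq rewrite eq  = ⇓-abs d

-- As `s` is no sum, no term on the way from `M` has a sum at its root, so every round of `L`
-- commutes with the abstraction.
⇓-lam : ∀ {M s} → ¬ Sum⊕ s → M ⇓ s → lam M ⇓ ƛ s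
⇓-lam ¬⊕ (now (hnf h))   = now (hnf (lam h))
⇓-lam ¬⊕ (now (left p))  = ⊥-elim (¬⊕ left)
⇓-lam ¬⊕ (now (right p)) = ⊥-elim (¬⊕ right)
⇓-lam {M} ¬⊕ (later d) with L-lam M
... | inj₁ (A , B , refl) = ⊥-elim (¬⊕ (⇓-sum d))
... | inj₂ eq = later (≡.subst (_⇓ _) (sym eq) (⇓-lam ¬⊕ d))

⇓-spine : ∀ {P Q s ts} n → Spine P s → All (Nf (iter n L Q)) ts → P · Q ⇓ ⟨ s ⟩ ts
⇓-spine zero p qs = now (hnf (spine (app p qs)))
⇓-spine {P} {Q} {ts = ts} (suc n) p qs =
  later (≡.subst (_⇓ _) (sym (L-varHead P Q (Spine⇒varHead p)))
          (⇓-spine n (Spine-L p)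
            (≡.subst (λ N → All (Nf N) ts) (sym (iter-shift n L Q)) qs)))

-- Three ways in which `L` can treat `P · Q`: `P` forms a redex with `Q`, a variable head lets `L`
-- enter both sides, or `L` works inside `P` alone.
AppStep : Λ → Set
AppStep P = (∀ {s} → P ⇓ s → Abs⊕ s) ⊎ varHead P ≡ true ⊎ (∀ Q → L (P · Q) ≡ L P · Q)

app-step : ∀ P → AppStep P
app-step (var x) = inj₂ (inj₁ refl)
app-step (lam M) = inj₁ ⇓-abs
app-step (A ⊕ B) = inj₁ (sum ∘ ⇓-sum)
app-step (P · P') with varHead P
... | true  = inj₂ (inj₁ refl)
... | false = inj₂ (inj₂ λ Q → refl)

-- The number `n` of rounds needed by the argument is fixed while `P` is evaluated. If `L` enters
-- `Q` meanwhile, stability of `Nf` keeps `n` sufficient; afterwards `⇓-spine` spends it.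
⇓-app : ∀ {P Q s ts} n → ¬ Abs⊕ s → P ⇓ s → All (Nf (iter n L Q)) ts → P · Q ⇓ ⟨ s ⟩ ts
⇓-app n ¬λ (now (hnf (spine p))) qs = ⇓-spine n p qs
⇓-app n ¬λ (now (hnf (lam h)))   qs = ⊥-elim (¬λ abs)
⇓-app n ¬λ (now (left p))        qs = ⊥-elim (¬λ (sum left))
⇓-app n ¬λ (now (right p))       qs = ⊥-elim (¬λ (sum right))
⇓-app {P} {Q} {ts = ts} n ¬λ (later d) qs with app-step P
... | inj₁ form = ⊥-elim (¬λ (form (later d)))
... | inj₂ (inj₁ eq) =
  later (≡.subst (_⇓ _) (sym (L-varHead P Q eq))
          (⇓-app n ¬λ d (≡.subst (λ N → All (Nf N) ts) (sym (iter-shift n L Q)) (AllNf-L qs))))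
... | inj₂ (inj₂ eq) = later (≡.subst (_⇓ _) (sym (eq Q)) (⇓-app n ¬λ d qs))

-- Head steps and inner steps

mutual
  data HeadSpine : ℕ → Label → Λ → Λ → Set where
    β     : ∀ {M Q} → HeadSpine 0 silent (lam M · Q) (subst 0 Q M)
    left  : ∀ {A B} → HeadSpine 0 left (A ⊕ B) A
    right : ∀ {A B} → HeadSpine 0 right (A ⊕ B) B
    app   : ∀ {n a P P' Q} → HeadSpine n a P P' → HeadSpine (suc n) a (P · Q) (P' · Q)

  -- The index counts the constructors above the contracted redex, that is,
  -- the applications of L a sum needs to reach the top.
  data Head : ℕ → Label → Λ → Λ → Set where
    spine : ∀ {n a M M'} → HeadSpine n a M M' → Head n a M M'
    lam   : ∀ {n a M M'} → Head n a M M' → Head (suc n) a (lam M) (lam M')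

-- The steps that are not head steps: they take place in the body of the abstraction of the head
-- β-redex.
data InnerSpine (a : Label) : Λ → Λ → Set where
  body : ∀ {M M' Q} → M ⟿[ a ] M' → InnerSpine a (lam M · Q) (lam M' · Q)
  app  : ∀ {P P' Q} → InnerSpine a P P' → InnerSpine a (P · Q) (P' · Q)

data Inner (a : Label) : Λ → Λ → Set where
  spine : ∀ {M M'} → InnerSpine a M M' → Inner a M M'
  lam   : ∀ {M M'} → Inner a M M' → Inner a (lam M) (lam M')

classify : ∀ {a M M'} → M ⟿[ a ] M' → (∃[ n ] Head n a M M') ⊎ Inner a M M'
classify ⟿β     = inj₁ (0 , spine β)
classify ⟿left  = inj₁ (0 , spine left)
classify ⟿right = inj₁ (0 , spine right)
classify (⟿lam r) with classify r
... | inj₁ (n , h) = inj₁ (suc n , lam h)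
... | inj₂ i       = inj₂ (lam i)
classify (⟿app (⟿lam r)) = inj₂ (spine (body r))
classify (⟿app {P = P · Q} r) with classify r
... | inj₁ (n , spine h) = inj₁ (suc n , spine (app h))
... | inj₂ (spine i)     = inj₂ (spine (app i))
classify (⟿app {P = A ⊕ B} r) with classify r
... | inj₁ (n , spine h) = inj₁ (suc n , spine (app h))
... | inj₂ (spine ())

HeadSpine-varHead : ∀ {n a M M'} → HeadSpine n a M M' → varHead M ≡ false
HeadSpine-varHead β       = refl
HeadSpine-varHead left    = refl
HeadSpine-varHead right   = refl
HeadSpine-varHead (app h) = HeadSpine-varHead h

-- A term with a head redex has no variable head, so `L` descends through function positions and
-- leaves the arguments alone.
L-silentSpine : ∀ {n M M'} → HeadSpine n silent M M' → L M ≡ M'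
L-silentSpine β       = refl
L-silentSpine (app β) = refl
L-silentSpine (app {Q = Q} (app {P = P} {Q = P'} h)) =
  ≡.trans (L-neutral P P' Q (HeadSpine-varHead h)) (cong (_· Q) (L-silentSpine (app h)))

L-silent : ∀ {n M M'} → Head n silent M M' → L M ≡ M'
L-silent (spine h)               = L-silentSpine h
L-silent (lam (spine β))         = refl
L-silent (lam (spine h@(app _))) = cong lam (L-silentSpine h)
L-silent (lam (lam h))           = cong lam (L-silent (lam h))

data Choice : Label → Set where
  left  : Choice left
  right : Choice right

L-choiceSpine : ∀ {n a M M'} → Choice a → HeadSpine (suc n) a M M' → HeadSpine n a (L M) M'
L-choiceSpine left  (app left)  = left
L-choiceSpine right (app right) = right
L-choiceSpine c (app {Q = Q} (app {P = P} {Q = P'} h))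
  rewrite L-neutral P P' Q (HeadSpine-varHead h) = app (L-choiceSpine c (app h))

-- The constructor that the sum passes is copied into both branches, so the chosen reduct `M'` stays
-- the same while the depth drops by one.
L-choice : ∀ {n a M M'} → Choice a → Head (suc n) a M M' → Head n a (L M) M'
L-choice c     (spine h)               = spine (L-choiceSpine c h)
L-choice left  (lam (spine left))      = spine left
L-choice right (lam (spine right))     = spine right
L-choice c     (lam (spine h@(app _))) = lam (spine (L-choiceSpine c h))
L-choice c     (lam (lam h))           = lam (L-choice c (lam h))

⇓-left : ∀ {A B s} → A ⇓ s → A ⊕ B ⇓ s ⊕•
⇓-left (now p)   = now (left p)
⇓-left (later d) = later (⇓-left d)

⇓-right : ∀ {A B s} → B ⇓ s → A ⊕ B ⇓ •⊕ s
⇓-right (now p)   = now (right p)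
⇓-right (later d) = later (⇓-right d)

⇓-choice : ∀ n {a M M' s} → Choice a → Head n a M M' → M' ⇓ s → M ⇓ act a s
⇓-choice zero    left  (spine left)  d = ⇓-left d
⇓-choice zero    right (spine right) d = ⇓-right d
⇓-choice (suc n) c     h             d = later (⇓-choice n c (L-choice c h) d)

⇓-head : ∀ {n a M M' s} → Head n a M M' → M' ⇓ s → M ⇓ act a s
⇓-head {a = silent} h d = later (≡.subst (_⇓ _) (sym (L-silent h)) d)
⇓-head {a = left}   h d = ⇓-choice _ left h d
⇓-head {a = right}  h d = ⇓-choice _ right h d

InnerSpine-varHead : ∀ {a M M'} → InnerSpine a M M' → varHead M ≡ false × varHead M' ≡ false
InnerSpine-varHead (body r) = refl , refl
InnerSpine-varHead (app i)  = InnerSpine-varHead i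

-- `L` contracts the enclosing β-redex. The inner step lies in its body, which is not duplicated, so
-- exactly one step is left; it may have become a head step.
L-innerSpine : ∀ {a M M'} → InnerSpine a M M' → L M ⟿[ a ] L M'
L-innerSpine (body r)       = ⟿-subst 0 _ r
L-innerSpine (app (body r)) = ⟿app (⟿-subst 0 _ r)
L-innerSpine (app {Q = R} (app {P} {P'} {Q} i)) =
  ≡.subst₂ _⟿[ _ ]_ (sym (L-neutral P Q R (proj₁ (InnerSpine-varHead i))))
                    (sym (L-neutral P' Q R (proj₂ (InnerSpine-varHead i))))
                    (⟿app (L-innerSpine (app i)))

L-inner : ∀ {a M M'} → Inner a M M' → L M ⟿[ a ] L M'
L-inner (spine i)                = L-innerSpine i
L-inner (lam (spine i@(body _))) = ⟿lam (L-innerSpine i)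
L-inner (lam (spine i@(app _)))  = ⟿lam (L-innerSpine i)
L-inner (lam (lam i))            = ⟿lam (L-inner (lam i))

-- An inner step leaves the enclosing β-redex in place.
InnerSpine⇒¬Spine : ∀ {a M M' s} → InnerSpine a M M' → ¬ Spine M' s
InnerSpine⇒¬Spine (body r) (app () _)
InnerSpine⇒¬Spine (app i)  (app p _) = InnerSpine⇒¬Spine i p

Inner⇒¬Hnf : ∀ {a M M' s} → Inner a M M' → ¬ Hnf M' s
Inner⇒¬Hnf (spine i)        (spine p) = InnerSpine⇒¬Spine i p
Inner⇒¬Hnf (spine ())       (lam h)
Inner⇒¬Hnf (lam i)          (lam h)   = Inner⇒¬Hnf i h

Inner⇒¬Nf : ∀ {a M M' s} → Inner a M M' → ¬ Nf M' s
Inner⇒¬Nf i         (hnf h) = Inner⇒¬Hnf i h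
Inner⇒¬Nf (spine ()) (left _)
Inner⇒¬Nf (spine ()) (right _)

-- The core of standardisation, by induction on `M' ⇓ s`. A head step is absorbed into rounds of
-- `L`. After an inner step `M'` is not normal, so it takes another round; the same round on `M`
-- leaves one step to treat again.
⇓-⟿ : ∀ {a M M' s} → M ⟿[ a ] M' → M' ⇓ s → M ⇓ act a s
⇓-⟿ r d with classify r
⇓-⟿ r d         | inj₁ (n , h) = ⇓-head h d
⇓-⟿ r (now p)   | inj₂ i       = ⊥-elim (Inner⇒¬Nf i p)
⇓-⟿ r (later d) | inj₂ i       = later (⇓-⟿ (L-inner i) d)

Normal-arg : ∀ {s ts} → Normal (⟨ s ⟩ ts) → ∀ {t} → t ∈ ts → Normal t
Normal-arg n t∈ E r with ∈-∃++ t∈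
... | _ , _ , refl = n _ (carg r)

mutual
  -- Normality supplies the shape conditions of `⇓-lam` and `⇓-app`: an excluded shape would make a
  -- redex at the root of the resource term.
  ⊩⇒⇓ : ∀ {M s} → M ⊩ s → Normal s → M ⇓ s
  ⊩⇒⇓ ⊩var n = now (hnf (spine var))
  ⊩⇒⇓ (⊩lam p) n = ⇓-lam (λ { left → n _ lam⊕• ; right → n _ lam•⊕ })
                         (⊩⇒⇓ p (λ E r → n _ (cƛ r)))
  ⊩⇒⇓ (⊩app p qs) n with All⇓⇒iter (All⊩⇒⇓ qs (Normal-arg n))
  ... | m , ds = ⇓-app m (λ { abs → n _ β ; (sum left) → n _ app⊕• ; (sum right) → n _ app•⊕ })
                         (⊩⇒⇓ p (λ E r → n _ (cfun r))) ds
  ⊩⇒⇓ (⊩step r p)  n = ⇓-⟿ r (⊩⇒⇓ p n)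
  ⊩⇒⇓ (⊩left r p)  n = ⇓-⟿ r (⊩⇒⇓ p (λ E r → n _ (c⊕• r)))
  ⊩⇒⇓ (⊩right r p) n = ⇓-⟿ r (⊩⇒⇓ p (λ E r → n _ (c•⊕ r)))

  All⊩⇒⇓ : ∀ {Q ts} → All (Q ⊩_) ts → (∀ {t} → t ∈ ts → Normal t) → All (Q ⇓_) ts
  All⊩⇒⇓ []       n = []
  All⊩⇒⇓ (q ∷ qs) n = ⊩⇒⇓ q (n (here refl)) ∷ All⊩⇒⇓ qs (n ∘ there)

-- Elementary Böhm trees

mutual
  ebtS-Spine : ∀ {M s} → Spine M s → ∃[ A ] ebtS M ≡ just A × 𝒯 A s
  ebtS-Spine var = _ , refl , 𝒯var
  ebtS-Spine (app {P} p qs) with ebtS P | ebtS-Spine p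
  ... | .(just A) | A , refl , t = _ , refl , 𝒯app t (All𝒯-eBT qs)

  ebtL-Hnf : ∀ {M s} → Hnf M s → ∃[ A ] ebtL M ≡ just A × 𝒯 A s
  ebtL-Hnf (spine p@var)       = ebtS-Spine p
  ebtL-Hnf (spine p@(app _ _)) = ebtS-Spine p
  ebtL-Hnf (lam {M} h) with ebtL M | ebtL-Hnf h
  ... | .(just A) | A , refl , t = _ , refl , 𝒯lam t

  𝒯-eBT : ∀ {M s} → Nf M s → 𝒯 (eBT M) s
  𝒯-eBT (left p)  = 𝒯⊕• (𝒯-eBT p)
  𝒯-eBT (right p) = 𝒯•⊕ (𝒯-eBT p)
  𝒯-eBT {var x} (hnf (spine var)) = 𝒯var
  𝒯-eBT {lam M} (hnf h) with ebtL-Hnf h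
  ... | A , eq , t = ≡.subst (λ m → 𝒯 (ebtOr m) _) (sym eq) t
  𝒯-eBT {P · Q} (hnf h) with ebtL-Hnf h
  ... | A , eq , t = ≡.subst (λ m → 𝒯 (ebtOr m) _) (sym eq) t
  𝒯-eBT {A ⊕ B} (hnf (spine ()))

  All𝒯-eBT : ∀ {Q ts} → All (Nf Q) ts → All (𝒯 (eBT Q)) ts
  All𝒯-eBT []       = []
  All𝒯-eBT (q ∷ qs) = 𝒯-eBT q ∷ All𝒯-eBT qs

mutual
  ebtS-sound : ∀ M {A} → ebtS M ≡ just A → 𝒩sp A × A ≤ ι M
  ebtS-sound (var x) refl = var𝒩sp , var≤
  ebtS-sound (P · Q) eq with ebtS P in eqP
  ebtS-sound (P · Q) refl | just A with ebtS-sound P eqP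
  ... | n , le = app𝒩sp n (𝒩-eBT Q) , app≤ le (eBT≤ι Q)

  ebtL-sound : ∀ M {A} → ebtL M ≡ just A → 𝒩λ A × A ≤ ι M
  ebtL-sound (lam M) eq with ebtL M in eqM
  ebtL-sound (lam M) refl | just A with ebtL-sound M eqM
  ... | n , le = lam𝒩λ n , lam≤ le
  ebtL-sound (var x) eq with ebtS-sound (var x) eq
  ... | n , le = sp𝒩λ n , le
  ebtL-sound (P · Q) eq with ebtS-sound (P · Q) eq
  ... | n , le = sp𝒩λ n , le

  -- The first half makes `eBT` of an iterate an admissible member of `BT`; the second places its
  -- Taylor support inside that of the iterate.
  eBT-sound : ∀ M → 𝒩 (eBT M) × eBT M ≤ ι M
  eBT-sound (var x) = hnf𝒩 (sp𝒩λ var𝒩sp) , var≤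
  eBT-sound (lam M) with ebtL (lam M) in eq
  ... | nothing = bot𝒩 , bot≤
  ... | just A with ebtL-sound (lam M) eq
  ... | n , le = hnf𝒩 n , le
  eBT-sound (P · Q) with ebtL (P · Q) in eq
  ... | nothing = bot𝒩 , bot≤
  ... | just A with ebtL-sound (P · Q) eq
  ... | n , le = hnf𝒩 n , le
  eBT-sound (A ⊕ B) =
    ⊕𝒩 (𝒩-eBT A) (𝒩-eBT B) , ⊕≤ (eBT≤ι A) (eBT≤ι B)

  𝒩-eBT : ∀ M → 𝒩 (eBT M)
  𝒩-eBT M = proj₁ (eBT-sound M)

  eBT≤ι : ∀ M → eBT M ≤ ι M
  eBT≤ι M = proj₂ (eBT-sound M)

≤ₐ-refl : ∀ A → A ≤ A
≤ₐ-refl bot      = bot≤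
≤ₐ-refl (avar x) = var≤
≤ₐ-refl (alam A) = lam≤ (≤ₐ-refl A)
≤ₐ-refl (A ·ₐ B) = app≤ (≤ₐ-refl A) (≤ₐ-refl B)
≤ₐ-refl (A ⊕ₐ B) = ⊕≤ (≤ₐ-refl A) (≤ₐ-refl B)

mutual
  𝒯-mono : ∀ {A B s} → A ≤ B → 𝒯 A s → 𝒯 B s
  𝒯-mono var≤         𝒯var        = 𝒯var
  𝒯-mono (lam≤ le)    (𝒯lam t)    = 𝒯lam (𝒯-mono le t)
  𝒯-mono (app≤ le le') (𝒯app t ts) = 𝒯app (𝒯-mono le t) (All𝒯-mono le' ts)
  𝒯-mono (⊕≤ le le')  (𝒯⊕• t)     = 𝒯⊕• (𝒯-mono le t)
  𝒯-mono (⊕≤ le le')  (𝒯•⊕ t)     = 𝒯•⊕ (𝒯-mono le' t)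

  All𝒯-mono : ∀ {A B ts} → A ≤ B → All (𝒯 A) ts → All (𝒯 B) ts
  All𝒯-mono le []       = []
  All𝒯-mono le (t ∷ ts) = 𝒯-mono le t ∷ All𝒯-mono le ts

-- Normality of the Taylor supports of elementary Böhm trees

data Neutral : RT → Set where
  var : ∀ {x} → Neutral (v x)
  app : ∀ {s ts} → Neutral (⟨ s ⟩ ts)

Normaapp-step : ∀ {s ts} → Neutral s → Normal s → All Normal ts → Normal (⟨ s ⟩ ts)
Normaapp-step () n ns _ β
Normaapp-step () n ns _ app⊕•
Normaapp-step () n ns _ app•⊕
Normaapp-step u n ns _ (cfun r)             = n _ r
Normaapp-step u n ns _ (carg {ts₁ = ts₁} r) = All.lookup ns (∈-++⁺ʳ ts₁ (here refl)) _ r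

mutual
  𝒩sp-Normal : ∀ {A s} → 𝒩sp A → 𝒯 A s → Neutral s × Normal s
  𝒩sp-Normal var𝒩sp 𝒯var = var , λ _ ()
  𝒩sp-Normal (app𝒩sp a b) (𝒯app t ts) with 𝒩sp-Normal a t
  ... | u , n = app , Normaapp-step u n (All𝒩-Normal b ts)

  -- Excluding sums strengthens the induction, since a sum under an abstraction would be a redex.
  𝒩λ-Normal : ∀ {A s} → 𝒩λ A → 𝒯 A s → ¬ Sum⊕ s × Normal s
  𝒩λ-Normal (lam𝒩λ a) (𝒯lam t) with 𝒩λ-Normal a t
  ... | ¬⊕ , n = (λ ()) , λ { _ lam⊕• → ¬⊕ left ; _ lam•⊕ → ¬⊕ right ; _ (cƛ r) → n _ r }
  𝒩λ-Normal (sp𝒩λ a) t with 𝒩sp-Normal a t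
  ... | var , n = (λ ()) , n
  ... | app , n = (λ ()) , n

  𝒩-Normal : ∀ {A s} → 𝒩 A → 𝒯 A s → Normal s
  𝒩-Normal (hnf𝒩 a) t = proj₂ (𝒩λ-Normal a t)
  𝒩-Normal (⊕𝒩 a b) (𝒯⊕• t) _ (c⊕• r) = 𝒩-Normal a t _ r
  𝒩-Normal (⊕𝒩 a b) (𝒯•⊕ t) _ (c•⊕ r) = 𝒩-Normal b t _ r

  All𝒩-Normal : ∀ {A ts} → 𝒩 A → All (𝒯 A) ts → All Normal ts
  All𝒩-Normal a []       = []
  All𝒩-Normal a (t ∷ ts) = 𝒩-Normal a t ∷ All𝒩-Normal a ts

-- Backward simulation of L

mutual
  -- Under a binder `subst` shifts `N`, so the bag found there has to be turned back into elements
  -- of `𝒯Λ N`.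
  𝒯-unshift : ∀ c M {s'} → 𝒯Λ (shift c M) s' → ∃[ s ] 𝒯Λ M s × s' ≡ shiftR c s
  𝒯-unshift c (var x) t with x <ᵇ c in eq
  𝒯-unshift c (var x) 𝒯var | true  = v x , 𝒯var , shifted
    where
    shifted : v x ≡ shiftR c (v x)
    shifted rewrite eq = refl
  𝒯-unshift c (var x) 𝒯var | false = v x , 𝒯var , shifted
    where
    shifted : v (suc x) ≡ shiftR c (v x)
    shifted rewrite eq = refl
  𝒯-unshift c (lam M) (𝒯lam t) with 𝒯-unshift (suc c) M t
  ... | s , t' , refl = ƛ s , 𝒯lam t' , refl
  𝒯-unshift c (P · Q) (𝒯app t ts) with 𝒯-unshift c P t | All𝒯-unshift c Q ts
  ... | s , t' , refl | us , ts' , refl = ⟨ s ⟩ us , 𝒯app t' ts' , refl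
  𝒯-unshift c (A ⊕ B) (𝒯⊕• t) with 𝒯-unshift c A t
  ... | s , t' , refl = s ⊕• , 𝒯⊕• t' , refl
  𝒯-unshift c (A ⊕ B) (𝒯•⊕ t) with 𝒯-unshift c B t
  ... | s , t' , refl = •⊕ s , 𝒯•⊕ t' , refl

  All𝒯-unshift : ∀ c M {ts'} → All (𝒯Λ (shift c M)) ts' →
                 ∃[ ts ] All (𝒯Λ M) ts × ts' ≡ shiftB c ts
  All𝒯-unshift c M [] = [] , [] , refl
  All𝒯-unshift c M (t ∷ ts) with 𝒯-unshift c M t | All𝒯-unshift c M ts
  ... | s , t' , refl | us , ts' , refl = s ∷ us , t' ∷ ts' , refl

mutual
  -- The bag is read off `r`: each occurrence of `k` contributes the resource term found in its
  -- place. Collecting them from left to right makes `r` a summand exactly, without permuting bags.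
  𝒯-unsubst : ∀ k N M {r} → 𝒯Λ (subst k N M) r →
              ∃₂ λ s us → 𝒯Λ M s × All (𝒯Λ N) us × r ∈ ∂ k s us
  𝒯-unsubst k N (var y) {r} t with y ≡ᵇ k in eq
  ... | true = v y , r ∷ [] , 𝒯var , t ∷ [] , r∈
    where
    r∈ : r ∈ ∂ k (v y) (r ∷ [])
    r∈ rewrite eq = here refl
  ... | false with y <ᵇ k in eq'
  𝒯-unsubst k N (var y) 𝒯var | false | true = v y , [] , 𝒯var , [] , r∈
    where
    r∈ : v y ∈ ∂ k (v y) []
    r∈ rewrite eq | eq' = here refl
  𝒯-unsubst k N (var y) 𝒯var | false | false = v y , [] , 𝒯var , [] , r∈
    where
    r∈ : v (pred y) ∈ ∂ k (v y) []
    r∈ rewrite eq | eq' = here refl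
  𝒯-unsubst k N (lam M) (𝒯lam t) with 𝒯-unsubst (suc k) (shift 0 N) M t
  ... | s , us' , t' , ns' , r∈ with All𝒯-unshift 0 N ns'
  ... | us , ns , refl = ƛ s , us , 𝒯lam t' , ns , ∈-map⁺ ƛ r∈
  𝒯-unsubst k N (P · Q) (𝒯app t ts) with 𝒯-unsubst k N P t | All𝒯-unsubst k N Q ts
  ... | s , vs , t' , ns₁ , s∈ | us , ws , ts' , ns₂ , us∈ =
    ⟨ s ⟩ us , vs ++ ws , 𝒯app t' ts' , Allₚ.++⁺ ns₁ ns₂ ,
    ∈-convolve⁺ ⟨_⟩_ (∂ k s) (∂B k us) vs ws s∈ us∈
  𝒯-unsubst k N (A ⊕ B) (𝒯⊕• t) with 𝒯-unsubst k N A t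
  ... | s , us , t' , ns , r∈ = s ⊕• , us , 𝒯⊕• t' , ns , ∈-map⁺ _⊕• r∈
  𝒯-unsubst k N (A ⊕ B) (𝒯•⊕ t) with 𝒯-unsubst k N B t
  ... | s , us , t' , ns , r∈ = •⊕ s , us , 𝒯•⊕ t' , ns , ∈-map⁺ •⊕_ r∈

  All𝒯-unsubst : ∀ k N Q {rs} → All (𝒯Λ (subst k N Q)) rs →
                 ∃₂ λ ts us → All (𝒯Λ Q) ts × All (𝒯Λ N) us × rs ∈ ∂B k ts us
  All𝒯-unsubst k N Q [] = [] , [] , [] , [] , here refl
  All𝒯-unsubst k N Q (t ∷ ts) with 𝒯-unsubst k N Q t | All𝒯-unsubst k N Q ts
  ... | s , vs , t' , ns₁ , s∈ | us , ws , ts' , ns₂ , us∈ =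
    s ∷ us , vs ++ ws , t' ∷ ts' , Allₚ.++⁺ ns₁ ns₂ ,
    ∈-convolve⁺ _∷_ (∂ k s) (∂B k us) vs ws s∈ us∈

infix 4 _⟶_ _⟶*_
-- Follows a single summand of each reduct; its companions are dealt with in `⟶*⇒InNF`.
_⟶_ : RT → RT → Set
s ⟶ s' = ∃[ E ] s ↦ E × s' ∈ E

_⟶*_ : RT → RT → Set
_⟶*_ = Star _⟶_

⟶*-ctx : ∀ {s s'} (f : RT → RT) → (∀ {s E} → s ↦ E → f s ↦ map f E) → s ⟶* s' → f s ⟶* f s'
⟶*-ctx f f-↦ = gmap f λ { (E , r , s'∈) → map f E , f-↦ r , ∈-map⁺ f s'∈ }

-- The prefix `us` collects the entries already reduced, so that `carg` can act on the next one.
⟶*-args : ∀ {s ts ts'} us → Pointwise _⟶*_ ts ts' → ⟨ s ⟩ (us ++ ts) ⟶* ⟨ s ⟩ (us ++ ts')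
⟶*-args us [] = ε
⟶*-args {s} {t ∷ ts} {t' ∷ ts'} us (r ∷ rs) =
  ⟶*-ctx (λ u → ⟨ s ⟩ (us ++ u ∷ ts)) carg r ◅◅
  ≡.subst₂ (λ as bs → ⟨ s ⟩ as ⟶* ⟨ s ⟩ bs)
           (++-assoc us (t' ∷ []) ts) (++-assoc us (t' ∷ []) ts')
           (⟶*-args (us ++ t' ∷ []) rs)

⟶*-app : ∀ {s s' ts ts'} → s ⟶* s' → Pointwise _⟶*_ ts ts' → ⟨ s ⟩ ts ⟶* ⟨ s' ⟩ ts'
⟶*-app {ts = ts} r rs = ⟶*-ctx (⟨_⟩ ts) cfun r ◅◅ ⟶*-args [] rs

⟶-unique : ∀ {s s'} → s ↦ (s' ∷ []) → s ⟶* s'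
⟶-unique r = (_ , r , here refl) ◅ ε

mutual
  -- Follows the clauses of `L`: a contracted β-redex is restored by `𝒯-unsubst`, a displaced sum by
  -- the resource rule that moves it, and each entry of a bag is expanded separately.
  expand : ∀ M {s'} → 𝒯Λ (L M) s' → ∃[ s ] 𝒯Λ M s × s ⟶* s'
  expand (var x) t = _ , t , ε
  expand (lam M) t with expandλ M t
  ... | s , t' , r = ƛ s , 𝒯lam t' , r
  expand (P · Q) t with expandₕ P Q t
  ... | s , us , t' , ts' , r = ⟨ s ⟩ us , 𝒯app t' ts' , r
  expand (A ⊕ B) (𝒯⊕• t) with expand A t
  ... | s , t' , r = s ⊕• , 𝒯⊕• t' , ⟶*-ctx _⊕• c⊕• r
  expand (A ⊕ B) (𝒯•⊕ t) with expand B t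
  ... | s , t' , r = •⊕ s , 𝒯•⊕ t' , ⟶*-ctx •⊕_ c•⊕ r

  expandλ : ∀ M {s'} → 𝒯Λ (Lλ M) s' → ∃[ s ] 𝒯Λ M s × ƛ s ⟶* s'
  expandλ (var x) (𝒯lam t) = _ , t , ε
  expandλ (lam M) (𝒯lam t) with expandλ M t
  ... | s , t' , r = ƛ s , 𝒯lam t' , ⟶*-ctx ƛ cƛ r
  expandλ (P · Q) (𝒯lam t) with expandₕ P Q t
  ... | s , us , t' , ts' , r = ⟨ s ⟩ us , 𝒯app t' ts' , ⟶*-ctx ƛ cƛ r
  expandλ (A ⊕ B) (𝒯⊕• (𝒯lam t)) = _ , 𝒯⊕• t , ⟶-unique lam⊕•
  expandλ (A ⊕ B) (𝒯•⊕ (𝒯lam t)) = _ , 𝒯•⊕ t , ⟶-unique lam•⊕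

  expandₕ : ∀ P Q {s'} → 𝒯Λ (Lh P Q) s' →
            ∃₂ λ s ts → 𝒯Λ P s × All (𝒯Λ Q) ts × ⟨ s ⟩ ts ⟶* s'
  expandₕ (var x) Q (𝒯app t ts) with AllExpand Q ts
  ... | us , ts' , rs = _ , us , t , ts' , ⟶*-app ε rs
  expandₕ (lam M) Q t with 𝒯-unsubst 0 Q M t
  ... | s , us , t' , ns , r∈ = ƛ s , us , 𝒯lam t' , ns , (_ , β , r∈) ◅ ε
  expandₕ (A ⊕ B) Q (𝒯⊕• (𝒯app t ts)) = _ , _ , 𝒯⊕• t , ts , ⟶-unique app⊕•
  expandₕ (A ⊕ B) Q (𝒯•⊕ (𝒯app t ts)) = _ , _ , 𝒯•⊕ t , ts , ⟶-unique app•⊕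
  expandₕ (P · P') Q t with varHead P
  expandₕ (P · P') Q (𝒯app t ts) | true with expandₕ P P' t | AllExpand Q ts
  ... | s , us , t' , ts' , r | ws , ns , rs = ⟨ s ⟩ us , ws , 𝒯app t' ts' , ns , ⟶*-app r rs
  expandₕ (P · P') Q (𝒯app t ts) | false with expandₕ P P' t
  ... | s , us , t' , ts' , r = ⟨ s ⟩ us , _ , 𝒯app t' ts' , ts , ⟶*-ctx (⟨_⟩ _) cfun r

  AllExpand : ∀ Q {ts'} → All (𝒯Λ (L Q)) ts' → ∃[ ts ] All (𝒯Λ Q) ts × Pointwise _⟶*_ ts ts'
  AllExpand Q [] = [] , [] , []
  AllExpand Q (t ∷ ts) with expand Q t | AllExpand Q ts
  ... | s , t' , r | us , ts' , rs = s ∷ us , t' ∷ ts' , r ∷ rs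

expand-iter : ∀ n M {s'} → 𝒯Λ (iter n L M) s' → ∃[ s ] 𝒯Λ M s × s ⟶* s'
expand-iter zero    M t = _ , t , ε
expand-iter (suc n) M t with expand (iter n L M) t
... | s , t' , r with expand-iter n M t'
... | e , t'' , r' = e , t'' , r' ◅◅ r

-- Weak normalisation of resource terms

mutual
  size : RT → ℕ
  size (v x)      = 1
  size (ƛ s)      = suc (size s)
  size (⟨ s ⟩ ts) = suc (size s + sizeB ts)
  size (s ⊕•)     = suc (size s)
  size (•⊕ s)     = suc (size s)

  sizeB : List RT → ℕ
  sizeB []       = 0
  sizeB (t ∷ ts) = size t + sizeB ts

-- The factors 2 make moving a sum outwards decrease the weight.
mutual
  weight : RT → ℕ
  weight (v x)      = 0
  weight (ƛ s)      = 2 * weight s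
  weight (⟨ s ⟩ ts) = 2 * weight s + weightB ts
  weight (s ⊕•)     = suc (weight s)
  weight (•⊕ s)     = suc (weight s)

  weightB : List RT → ℕ
  weightB []       = 0
  weightB (t ∷ ts) = weight t + weightB ts

mutual
  size-shift : ∀ c s → size (shiftR c s) ≡ size s
  size-shift c (v x) with x <ᵇ c
  ... | true  = refl
  ... | false = refl
  size-shift c (ƛ s)      = cong suc (size-shift (suc c) s)
  size-shift c (⟨ s ⟩ ts) = cong suc (cong₂ _+_ (size-shift c s) (sizeB-shift c ts))
  size-shift c (s ⊕•)     = cong suc (size-shift c s)
  size-shift c (•⊕ s)     = cong suc (size-shift c s)

  sizeB-shift : ∀ c ts → sizeB (shiftB c ts) ≡ sizeB ts
  sizeB-shift c []       = refl
  sizeB-shift c (t ∷ ts) = cong₂ _+_ (size-shift c t) (sizeB-shift c ts)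

sizeB-++ : ∀ ts us → sizeB (ts ++ us) ≡ sizeB ts + sizeB us
sizeB-++ []       us = refl
sizeB-++ (t ∷ ts) us = ≡.trans (cong (size t +_) (sizeB-++ ts us))
                               (sym (+-assoc (size t) (sizeB ts) (sizeB us)))

sizeB-↭ : ∀ {ts us} → ts ↭ us → sizeB ts ≡ sizeB us
sizeB-↭ refl           = refl
sizeB-↭ (prep t p)     = cong (size t +_) (sizeB-↭ p)
sizeB-↭ (swap {ts} {us} t u p) = begin
  size t + (size u + sizeB ts) ≡⟨ +-assoc (size t) (size u) (sizeB ts) ⟨
  size t + size u + sizeB ts   ≡⟨ cong₂ _+_ (+-comm (size t) (size u)) (sizeB-↭ p) ⟩
  size u + size t + sizeB us   ≡⟨ +-assoc (size u) (size t) (sizeB us) ⟩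
  size u + (size t + sizeB us) ∎
  where open ≡-Reasoning
sizeB-↭ (trans p q)    = ≡.trans (sizeB-↭ p) (sizeB-↭ q)

size-split-≤ : ∀ {x y us} vs ws a b → us ↭ vs ++ ws →
  x ≤ℕ a + sizeB vs → y ≤ℕ b + sizeB ws → x + y ≤ℕ a + b + sizeB us
size-split-≤ {x} {y} {us} vs ws a b us↭ x≤ y≤ = begin
  x + y                             ≤⟨ +-mono-≤ x≤ y≤ ⟩
  (a + sizeB vs) + (b + sizeB ws)   ≡⟨ interchange a (sizeB vs) b (sizeB ws) ⟩
  (a + b) + (sizeB vs + sizeB ws)   ≡⟨ cong (a + b +_) (sizeB-++ vs ws) ⟨
  (a + b) + sizeB (vs ++ ws)        ≡⟨ cong (a + b +_) (sizeB-↭ us↭) ⟨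
  a + b + sizeB us                  ∎
  where
  open ≤-Reasoning

mutual
  -- Every entry of the bag is used exactly once, so nothing is duplicated. Hence a β-step, which
  -- also deletes an abstraction and an application, shrinks each summand.
  size-∂ : ∀ k s us {r} → r ∈ ∂ k s us → size r ≤ℕ size s + sizeB us
  size-∂ k (v y) [] r∈ with y ≡ᵇ k
  size-∂ k (v y) [] () | true
  ... | false with y <ᵇ k
  size-∂ k (v y) [] (here refl) | false | true  = ≤-refl
  size-∂ k (v y) [] (here refl) | false | false = ≤-refl
  size-∂ k (v y) (u ∷ []) r∈ with y ≡ᵇ k
  size-∂ k (v y) (u ∷ []) (here refl) | true  = ≤-trans (m≤m+n (size u) 0) (n≤1+n _)
  size-∂ k (v y) (u ∷ []) ()          | false
  size-∂ k (v y) (_ ∷ _ ∷ _) ()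
  size-∂ k (ƛ s) us r∈ with ∈-map⁻ ƛ r∈
  ... | r , r∈′ , refl = s≤s (≡.subst (λ n → size r ≤ℕ size s + n) (sizeB-shift 0 us)
                                      (size-∂ (suc k) s (shiftB 0 us) r∈′))
  size-∂ k (⟨ s ⟩ ts) us r∈ with ∈-convolve⁻ ⟨_⟩_ (∂ k s) (∂B k ts) us r∈
  ... | vs , ws , us↭ , _ , _ , s'∈ , ts'∈ , refl =
    s≤s (size-split-≤ vs ws (size s) (sizeB ts) us↭ (size-∂ k s vs s'∈) (sizeB-∂B k ts ws ts'∈))
  size-∂ k (s ⊕•) us r∈ with ∈-map⁻ _⊕• r∈
  ... | _ , r∈′ , refl = s≤s (size-∂ k s us r∈′)
  size-∂ k (•⊕ s) us r∈ with ∈-map⁻ •⊕_ r∈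
  ... | _ , r∈′ , refl = s≤s (size-∂ k s us r∈′)

  sizeB-∂B : ∀ k ts us {rs} → rs ∈ ∂B k ts us → sizeB rs ≤ℕ sizeB ts + sizeB us
  sizeB-∂B k [] [] (here refl) = ≤-refl
  sizeB-∂B k (t ∷ ts) us r∈ with ∈-convolve⁻ _∷_ (∂ k t) (∂B k ts) us r∈
  ... | vs , ws , us↭ , _ , _ , t'∈ , ts'∈ , refl =
    size-split-≤ vs ws (size t) (sizeB ts) us↭ (size-∂ k t vs t'∈) (sizeB-∂B k ts ws ts'∈)

-- A β-step lowers the size, whatever happens to the weight; moving a sum outwards keeps the size
-- and lowers the weight.
measure : RT → ℕ × ℕ
measure s = size s , weight s

infix 4 _≺_
_≺_ : RT → RT → Set
s ≺ t = ×-Lex _≡_ _<_ _<_ (measure s) (measure t)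

≺-wellFounded : WellFounded _≺_
≺-wellFounded = On.wellFounded measure (×-wellFounded <-wellFounded <-wellFounded)

2*suc : ∀ n → suc (suc (2 * n)) ≡ 2 * suc n
2*suc n = sym (*-suc 2 n)

≺-ƛ : ∀ {s t} → s ≺ t → ƛ s ≺ ƛ t
≺-ƛ (inj₁ lt)        = inj₁ (s≤s lt)
≺-ƛ (inj₂ (eq , lt)) = inj₂ (cong suc eq , *-monoʳ-< 2 lt)

≺-⊕• : ∀ {s t} → s ≺ t → s ⊕• ≺ t ⊕•
≺-⊕• (inj₁ lt)        = inj₁ (s≤s lt)
≺-⊕• (inj₂ (eq , lt)) = inj₂ (cong suc eq , s≤s lt)

≺-•⊕ : ∀ {s t} → s ≺ t → •⊕ s ≺ •⊕ t
≺-•⊕ (inj₁ lt)        = inj₁ (s≤s lt)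
≺-•⊕ (inj₂ (eq , lt)) = inj₂ (cong suc eq , s≤s lt)

≺-fun : ∀ {s t} us → s ≺ t → ⟨ s ⟩ us ≺ ⟨ t ⟩ us
≺-fun us (inj₁ lt)        = inj₁ (s≤s (+-monoˡ-< (sizeB us) lt))
≺-fun us (inj₂ (eq , lt)) =
  inj₂ (cong (λ n → suc (n + sizeB us)) eq , +-monoˡ-< (weightB us) (*-monoʳ-< 2 lt))

≺-bag : ∀ {s t} us ws → s ≺ t →
        ×-Lex _≡_ _<_ _<_ (sizeB (us ++ s ∷ ws) , weightB (us ++ s ∷ ws))
                          (sizeB (us ++ t ∷ ws) , weightB (us ++ t ∷ ws))
≺-bag []       ws (inj₁ lt)        = inj₁ (+-monoˡ-< (sizeB ws) lt)
≺-bag []       ws (inj₂ (eq , lt)) = inj₂ (cong (_+ sizeB ws) eq , +-monoˡ-< (weightB ws) lt)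
≺-bag (u ∷ us) ws lt with ≺-bag us ws lt
... | inj₁ lt′        = inj₁ (+-monoʳ-< (size u) lt′)
... | inj₂ (eq , lt′) = inj₂ (cong (size u +_) eq , +-monoʳ-< (weight u) lt′)

≺-arg : ∀ {s t} a us ws → s ≺ t → ⟨ a ⟩ (us ++ s ∷ ws) ≺ ⟨ a ⟩ (us ++ t ∷ ws)
≺-arg a us ws lt with ≺-bag us ws lt
... | inj₁ lt′        = inj₁ (s≤s (+-monoʳ-< (size a) lt′))
... | inj₂ (eq , lt′) = inj₂ (cong (λ n → suc (size a + n)) eq , +-monoʳ-< (2 * weight a) lt′)

↦⇒≺ : ∀ {e E e'} → e ↦ E → e' ∈ E → e' ≺ e
↦⇒≺ (β {s} {ts}) e'∈ = inj₁ (s≤s (≤-trans (size-∂ 0 s ts e'∈) (n≤1+n _)))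
-- The weight drops by exactly one: the contribution 2(w + 1) of the function becomes 2w + 1.
↦⇒≺ (app⊕• {s} {ts}) (here refl) =
  inj₂ (refl , +-monoˡ-≤ (weightB ts) (≤-reflexive (2*suc (weight s))))
↦⇒≺ (app•⊕ {s} {ts}) (here refl) =
  inj₂ (refl , +-monoˡ-≤ (weightB ts) (≤-reflexive (2*suc (weight s))))
↦⇒≺ (lam⊕• {s}) (here refl) = inj₂ (refl , ≤-reflexive (2*suc (weight s)))
↦⇒≺ (lam•⊕ {s}) (here refl) = inj₂ (refl , ≤-reflexive (2*suc (weight s)))
↦⇒≺ (cƛ r) e'∈ with ∈-map⁻ ƛ e'∈
... | _ , s'∈ , refl = ≺-ƛ (↦⇒≺ r s'∈)
↦⇒≺ (cfun {ts = ts} r) e'∈ with ∈-map⁻ _ e'∈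
... | _ , s'∈ , refl = ≺-fun ts (↦⇒≺ r s'∈)
↦⇒≺ (carg {s} {ts₁ = ts₁} {ts₂} r) e'∈ with ∈-map⁻ _ e'∈
... | _ , t'∈ , refl = ≺-arg s ts₁ ts₂ (↦⇒≺ r t'∈)
↦⇒≺ (c⊕• r) e'∈ with ∈-map⁻ _⊕• e'∈
... | _ , s'∈ , refl = ≺-⊕• (↦⇒≺ r s'∈)
↦⇒≺ (c•⊕ r) e'∈ with ∈-map⁻ •⊕_ e'∈
... | _ , s'∈ , refl = ≺-•⊕ (↦⇒≺ r s'∈)

Reducible : RT → Set
Reducible s = ∃[ E ] s ↦ E

mutual
  progress : ∀ s → Normal s ⊎ Reducible s
  progress (v x) = inj₁ λ _ ()
  progress (ƛ (s ⊕•)) = inj₂ (_ , lam⊕•)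
  progress (ƛ (•⊕ s)) = inj₂ (_ , lam•⊕)
  progress (ƛ s@(v _)) = inj₁ λ { _ (cƛ ()) }
  progress (ƛ s@(ƛ _)) with progress s
  ... | inj₁ n       = inj₁ λ { _ (cƛ r) → n _ r }
  ... | inj₂ (_ , r) = inj₂ (_ , cƛ r)
  progress (ƛ s@(⟨ _ ⟩ _)) with progress s
  ... | inj₁ n       = inj₁ λ { _ (cƛ r) → n _ r }
  ... | inj₂ (_ , r) = inj₂ (_ , cƛ r)
  progress (⟨ ƛ s ⟩ ts)    = inj₂ (_ , β)
  progress (⟨ s ⊕• ⟩ ts)   = inj₂ (_ , app⊕•)
  progress (⟨ •⊕ s ⟩ ts)   = inj₂ (_ , app•⊕)
  progress (⟨ s@(v _) ⟩ ts) with progressB ts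
  ... | inj₁ ns                       = inj₁ (Normaapp-step var (λ _ ()) ns)
  ... | inj₂ (_ , _ , _ , refl , _ , r) = inj₂ (_ , carg r)
  progress (⟨ s@(⟨ _ ⟩ _) ⟩ ts) with progress s | progressB ts
  ... | inj₂ (_ , r) | _                                = inj₂ (_ , cfun r)
  ... | inj₁ n       | inj₁ ns                          = inj₁ (Normaapp-step app n ns)
  ... | inj₁ n       | inj₂ (_ , _ , _ , refl , _ , r) = inj₂ (_ , carg r)
  progress (s ⊕•) with progress s
  ... | inj₁ n       = inj₁ λ { _ (c⊕• r) → n _ r }
  ... | inj₂ (_ , r) = inj₂ (_ , c⊕• r)
  progress (•⊕ s) with progress s
  ... | inj₁ n       = inj₁ λ { _ (c•⊕ r) → n _ r }
  ... | inj₂ (_ , r) = inj₂ (_ , c•⊕ r)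

  progressB : ∀ ts → All Normal ts ⊎
              (∃[ us ] ∃[ t ] ∃[ ws ] ts ≡ us ++ t ∷ ws × Reducible t)
  progressB [] = inj₁ []
  progressB (t ∷ ts) with progress t | progressB ts
  ... | inj₂ r | _                              = inj₂ ([] , t , ts , refl , r)
  ... | inj₁ n | inj₁ ns                        = inj₁ (n ∷ ns)
  ... | inj₁ n | inj₂ (us , u , ws , refl , r) = inj₂ (t ∷ us , u , ws , refl , r)

⇒-++ʳ : ∀ G {E F} → E ⇒ F → (E ++ G) ⇒ (F ++ G)
⇒-++ʳ G (step {E₁} {e} {E'} {E₂} r)
  rewrite ++-assoc E₁ (e ∷ E₂) G | ++-assoc E₁ (E' ++ E₂) G | ++-assoc E' E₂ G = step r

⇒-++ˡ : ∀ G {E F} → E ⇒ F → (G ++ E) ⇒ (G ++ F)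
⇒-++ˡ G (step {E₁} {e} {E'} {E₂} r)
  rewrite sym (++-assoc G E₁ (e ∷ E₂)) | sym (++-assoc G E₁ (E' ++ E₂)) = step r

⇒*-++ : ∀ {E E' F F'} → E ⇒* E' → F ⇒* F' → (E ++ F) ⇒* (E' ++ F')
⇒*-++ {E' = E'} {F} rs rs' = gmap (_++ F) (⇒-++ʳ F) rs ◅◅ gmap (E' ++_) (⇒-++ˡ E') rs'

↦⇒⇒* : ∀ {e E} → e ↦ E → (e ∷ []) ⇒* E
↦⇒⇒* {e} {E} r = ≡.subst ((e ∷ []) ⇒*_) (++-identityʳ E) (step {[]} {E₂ = []} r ◅ ε)

Normalises : Sum → Set
Normalises E = ∃[ F ] (E ⇒* F) × All Normal F

normalises-sum : ∀ {E} → All (λ e → Normalises (e ∷ [])) E → Normalises E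
normalises-sum [] = [] , ε , []
normalises-sum ((F , r , n) ∷ ps) with normalises-sum ps
... | G , rs , ns = F ++ G , ⇒*-++ r rs , Allₚ.++⁺ n ns

normalises : ∀ E → Normalises E
normalises E = normalises-sum (All.universal (λ e → go e (≺-wellFounded e)) E)
  where
  go : ∀ e → Acc _≺_ e → Normalises (e ∷ [])
  go e (acc rec) with progress e
  ... | inj₁ n       = e ∷ [] , ε , n ∷ []
  ... | inj₂ (E , r) with normalises-sum (All.tabulate λ {e'} e'∈ → go e' (rec (↦⇒≺ r e'∈)))
  ... | F , rs , ns = F , ↦⇒⇒* r ◅◅ rs , ns

-- At each step the followed summand sits between `E₁` and `E₂`. These are normalised on their own,
-- so the final sum is normal and still contains `s`.
⟶*⇒InNF : ∀ {e s} → e ⟶* s → Normal s → InNF e s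
⟶*⇒InNF ε n = _ , ε , n ∷ [] , here refl
⟶*⇒InNF ((E , r , e'∈) ◅ rs) n with ⟶*⇒InNF rs n | ∈-∃++ e'∈
... | F , rsF , nF , s∈ | E₁ , E₂ , refl with normalises E₁ | normalises E₂
... | F₁ , rs₁ , n₁ | F₂ , rs₂ , n₂ =
  F₁ ++ F ++ F₂ ,
  ↦⇒⇒* r ◅◅ ⇒*-++ rs₁ (⇒*-++ rsF rs₂) ,
  Allₚ.++⁺ n₁ (Allₚ.++⁺ nF n₂) ,
  ∈-++⁺ʳ F₁ (∈-++⁺ˡ s∈)

-- The two inclusions

mutual
  ≈-refl : ∀ s → s ≈ s
  ≈-refl (v x)      = v≈
  ≈-refl (ƛ s)      = ƛ≈ (≈-refl s)
  ≈-refl (⟨ s ⟩ ts) = app≈ (≈-refl s) (≈ᵇ-refl ts)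
  ≈-refl (s ⊕•)     = ⊕•≈ (≈-refl s)
  ≈-refl (•⊕ s)     = •⊕≈ (≈-refl s)

  ≈ᵇ-refl : ∀ ts → ts ≈ᵇ ts
  ≈ᵇ-refl []       = []≈ᵇ
  ≈ᵇ-refl (t ∷ ts) = ∷≈ᵇ {us₁ = []} (≈-refl t) (≈ᵇ-refl ts)

-- Monotonicity along `B ≤ eBT (iter n L M)` and `eBT≤ι` puts `s` in the Taylor support of the
-- iterate, from which it is expanded back to `M`; it is normal because `B` lies in `𝒩`.
𝒯BT⊆NF : ∀ M {s} → 𝒯BT M s → NF (𝒯Λ M) s
𝒯BT⊆NF M (B , (B𝒩 , n , B≤) , t)
  with expand-iter n M (𝒯-mono (eBT≤ι (iter n L M)) (𝒯-mono B≤ t))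
... | e , e∈ , r = e , e∈ , ⟶*⇒InNF r (𝒩-Normal B𝒩 t)

NF⊆𝒯BT : ∀ M {s} → NF (𝒯Λ M) s → 𝒯BT M s
NF⊆𝒯BT M (e , e∈ , F , rs , nF , s∈)
  with ⇓⇒iter (⊩⇒⇓ (All.lookup (⊩-⇒* rs (𝒯⇒⊩ M e∈ ∷ [])) s∈) (All.lookup nF s∈))
... | n , p =
  -- The whole `eBT` of the iterate serves as the approximant, so its bound is reflexivity.
  eBT (iter n L M) , (𝒩-eBT (iter n L M) , n , ≤ₐ-refl _) , 𝒯-eBT p

theorem4p10 : ∀ (M : Λ) → 𝒯BT M ≐ NF (𝒯Λ M)
theorem4p10 M = (λ s p → s , 𝒯BT⊆NF M p , ≈-refl s) , (λ s p → s , NF⊆𝒯BT M p , ≈-refl s)
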